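{- Let $n\ge1$ and for integers $m,k$ let $g_n(m,k)=\#\{t\in\mathfrak T_{2n+1}:\mathrm{eoc}(t)=m,\ \mathrm{pom}(t)=k\}$. Let $(m,k)$ satisfy either $2\le k+1\le m\le 2n-2$ or $4\le m+3\le k\le 2n$. Let $h_n(m,k)$ be the number of trees $t\in\mathfrak T_{2n+1}$ with $\mathrm{eoc}(t)=m+1$ and $\mathrm{pom}(t)=k$ such that the vertex $m$ has exactly the two children $m+1$ and $m+2$, both of which are leaves. Then $$g_n(m+2,k)-2g_n(m+1,k)+g_n(m,k)+2h_n(m,k)=0.$$
   Context: A strictly ordered binary tree on $N$ vertices is a rooted tree whose vertices are labeled bijectively by $1,\dots,N$, the root being labeled $1$, in which every vertex has either no child (a leaf) or exactly two children (their order is immaterial), and labels increase along every path from the root. $\mathfrak T_{2n+1}$ denotes the set of these trees on $2n+1$ vertices. For $t\in\mathfrak T_{2n+1}$ ($n\ge1$): the minimal chain starts at the root and repeatedly moves to the child with the smaller label until a leaf is reached; $\mathrm{eoc}(t)$ is the label of that leaf. The vertex $2n+1$ is a leaf, and $\mathrm{pom}(t)$ is the label of its parent. -}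

module Defs where

open import Data.Nat using (ℕ; zero; suc; _+_; _*_; _∸_; _≟_)
open import Data.List using (List; []; _∷_; _++_; map; concatMap; filter; length; upTo; zip)
open import Data.List.Relation.Unary.All using (All; all?)
open import Data.Product using (_×_; _,_; proj₁; proj₂)
open import Data.Product.Properties using (≡-dec)
open import Data.Sum using (_⊎_)
open import Relation.Nullary using (Dec)
open import Relation.Nullary.Decidable using (_⊎-dec_; _×-dec_)
open import Relation.Binary.PropositionalEquality using (_≡_)
open import Data.List.Properties using () renaming (≡-dec to list-≡-dec)

-- A rooted tree on the vertex set {1,…,N} with root 1 and labels increasing
-- along every path is the same thing as a parent function p with
-- 1 ≤ p(v) < v for v = 2,…,N.  We encode it by the list
--   ps = [ p(2) , p(3) , … , p(N) ].
-- (Children are unordered, which this encoding respects automatically.)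

candidates : ℕ → List (List ℕ)
candidates zero = []
candidates (suc zero) = [] ∷ []
candidates (suc (suc k)) =
  concatMap (λ ps → map (λ p → ps ++ (p ∷ [])) (map suc (upTo (suc k))))
            (candidates (suc k))

labeled : List ℕ → List (ℕ × ℕ)
labeled ps = zip (map (λ i → suc (suc i)) (upTo (length ps))) ps

children : List ℕ → ℕ → List ℕ
children ps u = map proj₁ (filter (λ vp → proj₂ vp ≟ u) (labeled ps))

IsBinary : ℕ → List ℕ → Set
IsBinary N ps = All (λ i → length (children ps (suc i)) ≡ 0 ⊎ length (children ps (suc i)) ≡ 2) (upTo N)

isBinary? : (N : ℕ) → (ps : List ℕ) → Dec (IsBinary N ps)
isBinary? N ps = all? (λ i → (length (children ps (suc i)) ≟ 0) ⊎-dec (length (children ps (suc i)) ≟ 2)) (upTo N)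

trees : ℕ → List (List ℕ)
trees N = filter (isBinary? N) (candidates N)

chainEnd : ℕ → List ℕ → ℕ → ℕ
chainEnd zero ps u = u
chainEnd (suc f) ps u with children ps u
... | [] = u
... | v ∷ _ = chainEnd f ps v

-- eoc(t): label of the leaf ending the minimal chain from the root 1
-- (fuel N-1 suffices since labels strictly increase along the chain)
eoc : List ℕ → ℕ
eoc ps = chainEnd (length ps) ps 1

-- parent of vertex v (0 if v has no parent)
parentOf : List ℕ → ℕ → ℕ
parentOf ps v with map proj₂ (filter (λ vp → proj₁ vp ≟ v) (labeled ps))
... | [] = 0
... | p ∷ _ = p

pom : ℕ → List ℕ → ℕ
pom n ps = parentOf ps (2 * n + 1)

g : ℕ → ℕ → ℕ → ℕ
g n m k = length (filter (λ t → (eoc t ≟ m) ×-dec (pom n t ≟ k)) (trees (2 * n + 1)))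

HCond : ℕ → List ℕ → Set
HCond m t = (children t m ≡ (m + 1) ∷ (m + 2) ∷ [])
          × ((children t (m + 1) ≡ []) × (children t (m + 2) ≡ []))

hCond? : (m : ℕ) → (t : List ℕ) → Dec (HCond m t)
hCond? m t = list-≡-dec _≟_ (children t m) ((m + 1) ∷ (m + 2) ∷ [])
   ×-dec (list-≡-dec _≟_ (children t (m + 1)) [] ×-dec list-≡-dec _≟_ (children t (m + 2)) [])

h : ℕ → ℕ → ℕ → ℕ
h n m k = length (filter (λ t → ((eoc t ≟ m + 1) ×-dec (pom n t ≟ k)) ×-dec hCond? m t) (trees (2 * n + 1)))

{-# OPTIONS --safe #-}
module Submission where

open import Defs
open import Data.Nat using (ℕ; zero; suc; _+_; _*_; _∸_; _≤_; _<_; z≤n; s≤s; _≟_; _<?_)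
open import Data.Nat.Properties
open import Data.Nat.Tactic.RingSolver using (solve-∀)
open import Data.Integer using (ℤ; +_) renaming (_+_ to _+ℤ_; _-_ to _-ℤ_; _*_ to _*ℤ_)
import Data.Integer.Properties as ℤ
open import Data.Integer.Tactic.RingSolver using () renaming (solve-∀ to ℤ-solve-∀)
open import Data.List using (List; []; _∷_; _++_; _∷ʳ_; map; concatMap; filter; length; upTo; applyUpTo; zip; cartesianProductWith)
open import Data.List.Properties using (length-map; length-++; map-∘; map-id-local; map-upTo; length-applyUpTo; applyUpTo-∷ʳ; ∷ʳ-injective) renaming (≡-dec to list-≡-dec)
open import Data.List.Membership.Propositional using (_∈_)
open import Data.List.Membership.Propositional.Properties
open import Data.List.Relation.Binary.Subset.Propositional using (_⊆_)
open import Data.List.Relation.Unary.All as All using ([]; _∷_)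
import Data.List.Relation.Unary.All.Properties as All
open import Data.List.Relation.Unary.Any using (here; there)
open import Data.List.Relation.Unary.AllPairs as AllPairs using (AllPairs; []; _∷_)
import Data.List.Relation.Unary.AllPairs.Properties as AllPairs
open import Data.List.Relation.Unary.Unique.Propositional using (Unique)
import Data.List.Relation.Unary.Unique.Propositional.Properties as Unique
open import Data.Product using (_×_; _,_; proj₁; proj₂; ∃; ∃₂)
open import Data.Sum using (_⊎_; inj₁; inj₂; [_,_]′)
open import Data.Empty using (⊥)
open import Function using (_∘_; id)
open import Level using (0ℓ)
open import Relation.Nullary using (¬_; Dec; yes; no; contradiction)
open import Relation.Nullary.Decidable using (_×-dec_; ¬?; toSum)
open import Relation.Unary using (Pred; Decidable)
open import Relation.Binary.PropositionalEquality

-- Write a = m, b = m+1, c = m+2 and p for the parent function.  A leaf e is eoc(t) iff every vertex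
-- on the path from the root to e is the smaller of its siblings.  Exchanging two adjacent labels j, j+1
-- that are neither siblings nor parent and child again gives a tree and transports eoc along the
-- exchange, so g(a), g(b), g(c) agree up to trees in which a, b, c are close relatives:
--   * eoc = a, p b ≠ p a          corresponds to  eoc = b, p b ≠ a,  and likewise with b, c for a, b;
--   * eoc = a, p b = p a, p c ≠ b corresponds to  eoc = b, p c = p b ≠ a;
--   * eoc = c, p c = b, p b ≠ a   corresponds to  eoc = b, p b = a, p c ∉ {a, p a}.
-- Moreover q{a,b{c,y}} corresponds to q{a{b,y},c}, and a{b{c,y},w} (c a leaf) is a{b,c{w,y}} (b a leaf)
-- with a choice of one of the children of c, hence twice as many.  The trees a{b,c} left over, with
-- b and c both leaves, are those counted by h, once in each of the two ways of decomposing g(b).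

-- Counting in duplicate-free lists.

module _ {A : Set} where

  length-⊆ : ∀ {xs ys : List A} → Unique xs → xs ⊆ ys → length xs ≤ length ys
  length-⊆ {[]} _ _ = z≤n
  length-⊆ {x ∷ xs} (x∉xs ∷ xs!) sub with ∈-∃++ (sub (here refl))
  ... | as , bs , refl = begin
    suc (length xs)                ≤⟨ s≤s (length-⊆ xs! sub′) ⟩
    suc (length (as ++ bs))        ≡⟨ cong suc (length-++ as) ⟩
    suc (length as + length bs)    ≡⟨ sym (+-suc (length as) (length bs)) ⟩
    length as + length (x ∷ bs)    ≡⟨ sym (length-++ as) ⟩
    length (as ++ x ∷ bs)          ∎
    where
    open ≤-Reasoning
    sub′ : xs ⊆ as ++ bs
    sub′ {z} z∈xs with ∈-++⁻ as (sub (there z∈xs))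
    ... | inj₁ z∈as         = ∈-++⁺ˡ z∈as
    ... | inj₂ (here z≡x)   = contradiction (sym z≡x) (All.lookup x∉xs z∈xs)
    ... | inj₂ (there z∈bs) = ∈-++⁺ʳ as z∈bs

  module _ {P Q : Pred A 0ℓ} (P? : Decidable P) (Q? : Decidable Q) {S : List A} (S! : Unique S) where

    -- `G` need only undo `F` on the trees counted. Mapping `G` over `map F fP` returns the
    -- duplicate-free list `fP`, so `map F fP` has no repetition either, and it lies inside
    -- `filter Q? S`.
    count-inj : (F G : A → A) →
      (∀ t → t ∈ S → P t → F t ∈ S × Q (F t) × G (F t) ≡ t) →
      length (filter P? S) ≤ length (filter Q? S)
    count-inj F G FG = subst (_≤ length (filter Q? S)) (length-map F fP)
                         (length-⊆ (Unique.map⁻ (subst Unique (sym GF) (Unique.filter⁺ P? S!))) sub)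
      where
      fP = filter P? S
      GF : map G (map F fP) ≡ fP
      GF = trans (sym (map-∘ fP)) (map-id-local (All.tabulate λ t∈ →
             let t∈S , Pt = ∈-filter⁻ P? t∈ in proj₂ (proj₂ (FG _ t∈S Pt))))
      sub : map F fP ⊆ filter Q? S
      sub u∈ with ∈-map⁻ F u∈
      ... | t , t∈ , refl = let t∈S , Pt = ∈-filter⁻ P? t∈
                                Ft∈S , QFt , _ = FG t t∈S Pt in ∈-filter⁺ Q? Ft∈S QFt

  module _ {P Q : Pred A 0ℓ} (P? : Decidable P) (Q? : Decidable Q) {S : List A} (S! : Unique S) where

    count-bij : (F G : A → A) →
      (∀ t → t ∈ S → P t → F t ∈ S × Q (F t) × G (F t) ≡ t) →
      (∀ t → t ∈ S → Q t → G t ∈ S × P (G t) × F (G t) ≡ t) →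
      length (filter P? S) ≡ length (filter Q? S)
    count-bij F G FG GF = ≤-antisym (count-inj P? Q? S! F G FG) (count-inj Q? P? S! G F GF)

  count-split : {P Q : Pred A 0ℓ} (P? : Decidable P) (Q? : Decidable Q) (S : List A) →
    length (filter P? S) ≡ length (filter (λ t → P? t ×-dec Q? t) S) + length (filter (λ t → P? t ×-dec ¬? (Q? t)) S)
  count-split P? Q? [] = refl
  count-split P? Q? (t ∷ S) with P? t | Q? t
  ... | no _  | _     = count-split P? Q? S
  ... | yes _ | yes _ = cong suc (count-split P? Q? S)
  ... | yes _ | no _  = trans (cong suc (count-split P? Q? S)) (sym (+-suc _ _))

-- Parent lists as functions of the index.

at : List ℕ → ℕ → ℕ
at []       _       = 0
at (x ∷ xs) zero    = x
at (x ∷ xs) (suc i) = at xs i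

at-∷ʳ : ∀ ps p {i} → i < length ps → at (ps ∷ʳ p) i ≡ at ps i
at-∷ʳ (x ∷ ps) p {zero}  _         = refl
at-∷ʳ (x ∷ ps) p {suc i} (s≤s i<l) = at-∷ʳ ps p i<l

at-∷ʳ-length : ∀ ps p → at (ps ∷ʳ p) (length ps) ≡ p
at-∷ʳ-length []       p = refl
at-∷ʳ-length (x ∷ ps) p = at-∷ʳ-length ps p

at-applyUpTo : ∀ f n {i} → i < n → at (applyUpTo f n) i ≡ f i
at-applyUpTo f (suc n) {zero}  _         = refl
at-applyUpTo f (suc n) {suc i} (s≤s i<n) = at-applyUpTo (f ∘ suc) n i<n

applyUpTo-at : ∀ f ps → (∀ {i} → i < length ps → f i ≡ at ps i) → applyUpTo f (length ps) ≡ ps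
applyUpTo-at f []       eq = refl
applyUpTo-at f (x ∷ ps) eq = cong₂ _∷_ (eq (s≤s z≤n)) (applyUpTo-at (f ∘ suc) ps (eq ∘ s≤s))

zip-applyUpTo : ∀ {A : Set} (f : ℕ → A) ps →
  zip (applyUpTo f (length ps)) ps ≡ applyUpTo (λ i → f i , at ps i) (length ps)
zip-applyUpTo f []       = refl
zip-applyUpTo f (x ∷ ps) = cong (_ ∷_) (zip-applyUpTo (f ∘ suc) ps)

labeled-at : ∀ ps → labeled ps ≡ applyUpTo (λ i → suc (suc i) , at ps i) (length ps)
labeled-at ps = trans (cong (λ l → zip l ps) (map-upTo (λ i → suc (suc i)) (length ps))) (zip-applyUpTo _ ps)

-- As a cartesian product the enumeration inherits uniqueness and both directions of membership from
-- the library.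
candidates-suc : ∀ k → candidates (suc (suc k)) ≡
  cartesianProductWith _∷ʳ_ (candidates (suc k)) (map suc (upTo (suc k)))
candidates-suc k = go (candidates (suc k))
  where
  go : ∀ xs → concatMap (λ ps → map (λ p → ps ++ (p ∷ [])) (map suc (upTo (suc k)))) xs ≡
              cartesianProductWith _∷ʳ_ xs (map suc (upTo (suc k)))
  go []       = refl
  go (x ∷ xs) = cong (map (x ∷ʳ_) (map suc (upTo (suc k))) ++_) (go xs)

candidates! : ∀ M → Unique (candidates (suc M))
candidates! zero    = [] ∷ []
candidates! (suc M) = subst Unique (sym (candidates-suc M))
  (Unique.cartesianProductWith⁺ _∷ʳ_ (∷ʳ-injective _ _) (candidates! M) (Unique.map⁺ suc-injective (Unique.upTo⁺ (suc M))))

-- Index `i` holds the parent of vertex `i + 2`, so the bound `suc i` says that a parent is smaller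
-- than its child.
candidates⁻ : ∀ M {t} → t ∈ candidates (suc M) →
  length t ≡ M × (∀ {i} → i < M → 1 ≤ at t i × at t i ≤ suc i)
candidates⁻ zero (here refl) = refl , λ ()
candidates⁻ (suc M) t∈
  with ∈-cartesianProductWith⁻ _∷ʳ_ (candidates (suc M)) _ (subst (_ ∈_) (candidates-suc M) t∈)
... | ps , p , ps∈ , p∈ , refl with candidates⁻ M ps∈ | ∈-map⁻ suc p∈
... | len , bd | q , q∈ , refl = trans (length-++ ps) (trans (+-comm (length ps) 1) (cong suc len)) , bd′
  where
  bd′ : ∀ {i} → i < suc M → 1 ≤ at (ps ∷ʳ suc q) i × at (ps ∷ʳ suc q) i ≤ suc i
  bd′ {i} (s≤s i≤M) with m≤n⇒m<n∨m≡n i≤M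
  ... | inj₁ i<M rewrite at-∷ʳ ps (suc q) (subst (i <_) (sym len) i<M) = bd i<M
  ... | inj₂ refl rewrite sym len | at-∷ʳ-length ps (suc q) = s≤s z≤n , ∈-upTo⁻ q∈

candidates⁺ : ∀ M f → (∀ {i} → i < M → 1 ≤ f i × f i ≤ suc i) → applyUpTo f M ∈ candidates (suc M)
candidates⁺ zero    f bd = here refl
candidates⁺ (suc M) f bd = subst₂ _∈_ (applyUpTo-∷ʳ f M) (sym (candidates-suc M))
  (∈-cartesianProductWith⁺ _∷ʳ_ (candidates⁺ M f (bd ∘ m≤n⇒m≤1+n)) fM∈)
  where
  fM∈ : f M ∈ map suc (upTo (suc M))
  fM∈ with f M | bd (n<1+n M)
  ... | suc q | _ , q<1+M = ∈-map⁺ suc (∈-upTo⁺ q<1+M)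

Sorted : List ℕ → Set
Sorted = AllPairs _<_

children-sorted : ∀ ps u → Sorted (children ps u)
children-sorted ps u rewrite labeled-at ps =
  AllPairs.map⁺ (AllPairs.filter⁺ (λ vp → proj₂ vp ≟ u)
    (AllPairs.applyUpTo⁺₁ _ (length ps) (λ i<j _ → s≤s (s≤s i<j))))

sorted⇒unique : ∀ {xs} → Sorted xs → Unique xs
sorted⇒unique = AllPairs.map <⇒≢

-- 0 at the labels 0 and 1, which have no parent, and beyond the end of the list.
par : List ℕ → ℕ → ℕ
par t (suc (suc i)) = at t i
par t _             = 0

-- Increasing binary trees as parent functions.

module Labels (M : ℕ) where

  N : ℕ
  N = suc M

  -- The labels of the vertices other than the root.
  R : ℕ → Set
  R v = 2 ≤ v × v ≤ N

  Leaf : (ℕ → ℕ) → ℕ → Set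
  Leaf p u = ∀ {v} → R v → p v ≢ u

  -- The children may come in either order, so a permutation of labels carries the record along
  -- without comparing their images.
  record Kids (p : ℕ → ℕ) (u x y : ℕ) : Set where
    constructor kids
    field
      Rx   : R x
      Ry   : R y
      x≢y  : x ≢ y
      px   : p x ≡ u
      py   : p y ≡ u
      only : ∀ {v} → R v → p v ≡ u → v ≡ x ⊎ v ≡ y

  Node : (ℕ → ℕ) → ℕ → Set
  Node p u = Leaf p u ⊎ ∃₂ (Kids p u)

  -- `node` ranges over all numbers, those outside `1..N` being leaves. A permutation can then be
  -- applied to `u` without tracking its range.
  record Tree (p : ℕ → ℕ) : Set where
    constructor tree
    field
      pos   : ∀ {v} → R v → 1 ≤ p v
      below : ∀ {v} → R v → p v < v
      node  : ∀ u → Node p u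
  open Tree public

  First : (ℕ → ℕ) → ℕ → Set
  First p x = ∀ {v} → R v → p v ≡ p x → x ≤ v

  -- The minimal chain read upwards: every vertex on it is the least child of its parent. Together
  -- with `Leaf` this characterizes `eoc` without fuel.
  data MinChain (p : ℕ → ℕ) : ℕ → Set where
    root : MinChain p 1
    step : ∀ {x} → R x → First p x → MinChain p (p x) → MinChain p x

  MinChain-inv : ∀ {p x} → 2 ≤ x → MinChain p x → First p x × MinChain p (p x)
  MinChain-inv (s≤s ()) root
  MinChain-inv _ (step _ f c) = f , c

  -- Ancestors of `x` are smaller than `x`, and only a smaller sibling can take a vertex off the
  -- chain; larger labels have no influence.
  MinChain-agree : ∀ {p p′ x} → Tree p → (∀ {v} → R v → v ≤ x → p v ≡ p′ v) → MinChain p x → MinChain p′ x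
  MinChain-agree T eq root = root
  MinChain-agree {p} {p′} {x} T eq (step Rx f c) = step Rx f′
    (subst (MinChain p′) (eq Rx ≤-refl) (MinChain-agree T (λ Rv v≤ → eq Rv (≤-trans v≤ (<⇒≤ (below T Rx)))) c))
    where
    f′ : First p′ x
    f′ {v} Rv e with ≤-total x v
    ... | inj₁ x≤v = x≤v
    ... | inj₂ v≤x = f Rv (trans (eq Rv v≤x) (trans e (sym (eq Rx ≤-refl))))

  Agree : (p p′ : ℕ → ℕ) → Set
  Agree p p′ = ∀ {v} → R v → p v ≡ p′ v

  Tree-resp : ∀ {p p′} → Agree p p′ → Tree p → Tree p′
  Tree-resp {p} {p′} eq T = tree (λ Rv → subst (1 ≤_) (eq Rv) (pos T Rv))
                        (λ Rv → subst (_< _) (eq Rv) (below T Rv)) nd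
    where
    nd : ∀ u → Node p′ u
    nd u with node T u
    ... | inj₁ l = inj₁ λ Rv e → l Rv (trans (eq Rv) e)
    ... | inj₂ (x , y , kids Rx Ry x≢y px py only) = inj₂ (x , y ,
            kids Rx Ry x≢y (trans (sym (eq Rx)) px) (trans (sym (eq Ry)) py) λ Rv e → only Rv (trans (eq Rv) e))

  build : (ℕ → ℕ) → List ℕ
  build f = applyUpTo (λ i → f (suc (suc i))) M

  par-build : ∀ f {v} → R v → par (build f) v ≡ f v
  par-build f {suc (suc i)} (_ , s≤s i<M) = at-applyUpTo _ M i<M
  par-build f {suc zero} (s≤s () , _)

  build-par : ∀ {t} f → length t ≡ M → Agree f (par t) → build f ≡ t
  build-par {t} f refl eq = applyUpTo-at _ t (λ i<l → eq (s≤s (s≤s z≤n) , s≤s i<l))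

  -- Dictionary between lists and parent functions.

  module _ (t : List ℕ) (len : length t ≡ M) where

    labeled⁺ : ∀ {i} → i < M → (suc (suc i) , at t i) ∈ labeled t
    labeled⁺ {i} i<M = subst ((suc (suc i) , at t i) ∈_) (sym (labeled-at t))
      (∈-applyUpTo⁺ (λ i → suc (suc i) , at t i) (subst (i <_) (sym len) i<M))

    children⁺ : ∀ {u v} → R v → par t v ≡ u → v ∈ children t u
    children⁺ {u} {suc zero} (s≤s () , _)
    children⁺ {u} {suc (suc i)} (_ , s≤s i<M) e = ∈-map∘filter⁺ proj₁ (λ vp → proj₂ vp ≟ u)
      (_ , labeled⁺ i<M , refl , e)

    children⁻ : ∀ {u v} → v ∈ children t u → R v × par t v ≡ u
    children⁻ {u} v∈ with ∈-map∘filter⁻ proj₁ (λ vp → proj₂ vp ≟ u) v∈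
    ... | _ , w∈ , refl , e with ∈-applyUpTo⁻ _ (subst (_ ∈_) (labeled-at t) w∈)
    ... | i , i<l , refl = (s≤s (s≤s z≤n) , s≤s (subst (i <_) len i<l)) , e

    leaf⁺ : ∀ {u} → children t u ≡ [] → Leaf (par t) u
    leaf⁺ eq Rv e with () ← subst (_ ∈_) eq (children⁺ Rv e)

    leaf⁻ : ∀ {u} → Leaf (par t) u → children t u ≡ []
    leaf⁻ {u} l with children t u in eq
    ... | []    = refl
    ... | v ∷ _ = let Rv , e = children⁻ (subst (v ∈_) (sym eq) (here refl)) in contradiction e (l Rv)

    kids⁺ : ∀ {u x y} → children t u ≡ x ∷ y ∷ [] → Kids (par t) u x y
    kids⁺ {u} {x} {y} eq = kids (proj₁ cx) (proj₁ cy) x≢y (proj₂ cx) (proj₂ cy) only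
      where
      cx = children⁻ {u} {x} (subst (x ∈_) (sym eq) (here refl))
      cy = children⁻ {u} {y} (subst (y ∈_) (sym eq) (there (here refl)))
      x≢y : x ≢ y
      x≢y with subst Sorted eq (children-sorted t u)
      ... | (x<y ∷ _) ∷ _ = <⇒≢ x<y
      only : ∀ {v} → R v → par t v ≡ u → v ≡ x ⊎ v ≡ y
      only Rv e with subst (_ ∈_) eq (children⁺ Rv e)
      ... | here v≡x         = inj₁ v≡x
      ... | there (here v≡y) = inj₂ v≡y

    kids⁻ : ∀ {u x y} → Kids (par t) u x y → length (children t u) ≡ 2
    kids⁻ {u} {x} {y} (kids Rx Ry x≢y px py only) = ≤-antisym
      (length-⊆ {ys = x ∷ y ∷ []} (sorted⇒unique (children-sorted t u)) sub)
      (length-⊆ {xs = x ∷ y ∷ []} ((x≢y ∷ []) ∷ [] ∷ [])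
        (λ { (here refl) → children⁺ Rx px ; (there (here refl)) → children⁺ Ry py }))
      where
      sub : children t u ⊆ x ∷ y ∷ []
      sub v∈ with children⁻ v∈
      ... | Rv , e with only Rv e
      ...   | inj₁ refl = here refl
      ...   | inj₂ refl = there (here refl)

    parents⁺ : ∀ {v} → R v → par t v ∈ map proj₂ (filter (λ vp → proj₁ vp ≟ v) (labeled t))
    parents⁺ {suc zero} (s≤s () , _)
    parents⁺ {suc (suc i)} (_ , s≤s i<M) = ∈-map∘filter⁺ proj₂ (λ vp → proj₁ vp ≟ suc (suc i))
      (_ , labeled⁺ i<M , refl , refl)

    parentOf-par : ∀ {v} → R v → parentOf t v ≡ par t v
    parentOf-par {v} Rv with map proj₂ (filter (λ vp → proj₁ vp ≟ v) (labeled t)) in eq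
    ... | [] with () ← subst (par t v ∈_) eq (parents⁺ Rv)
    parentOf-par {v} Rv | q ∷ _ with ∈-map∘filter⁻ proj₂ (λ vp → proj₁ vp ≟ v) (subst (q ∈_) (sym eq) (here refl))
    ... | _ , w∈ , refl , e with ∈-applyUpTo⁻ _ (subst (_ ∈_) (labeled-at t) w∈)
    ... | i , i<l , refl = cong (par t) e

  trees! : Unique (trees N)
  trees! = Unique.filter⁺ (isBinary? N) (candidates! M)

  ∈-trees⇒length : ∀ {t} → t ∈ trees N → length t ≡ M
  ∈-trees⇒length t∈ = proj₁ (candidates⁻ M (proj₁ (∈-filter⁻ (isBinary? N) t∈)))

  ∈-trees⇒tree : ∀ {t} → t ∈ trees N → Tree (par t)
  ∈-trees⇒tree {t} t∈ = tree ps bl nd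
    where
    len = ∈-trees⇒length t∈
    bds = proj₂ (candidates⁻ M (proj₁ (∈-filter⁻ (isBinary? N) t∈)))
    bin = All.applyUpTo⁻ id N (proj₂ (∈-filter⁻ (isBinary? N) {xs = candidates N} t∈))
    ps : ∀ {v} → R v → 1 ≤ par t v
    ps {suc zero} (s≤s () , _)
    ps {suc (suc i)} (_ , s≤s i<M) = proj₁ (bds i<M)
    bl : ∀ {v} → R v → par t v < v
    bl {suc zero} (s≤s () , _)
    bl {suc (suc i)} (_ , s≤s i<M) = s≤s (proj₂ (bds i<M))
    fromLength : ∀ u → length (children t u) ≡ 0 ⊎ length (children t u) ≡ 2 → Node (par t) u
    fromLength u l with children t u in eq
    fromLength u l | []            = inj₁ (leaf⁺ t len eq)
    fromLength u l | x ∷ y ∷ []    = inj₂ (x , y , kids⁺ t len eq)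
    fromLength u (inj₁ ()) | x ∷ []
    fromLength u (inj₂ ()) | x ∷ []
    fromLength u (inj₁ ()) | _ ∷ _ ∷ _ ∷ _
    fromLength u (inj₂ ()) | _ ∷ _ ∷ _ ∷ _
    nd : ∀ u → Node (par t) u
    nd zero = inj₁ λ Rv e → <⇒≢ (ps Rv) (sym e)
    nd (suc u) with u <? N
    ... | yes u<N = fromLength (suc u) (bin u<N)
    -- A child exceeds its parent, so a label beyond `N` has none.
    ... | no  u≮N = inj₁ λ Rv e → u≮N (≤-trans (n≤1+n _) (≤-trans (subst (_< _) e (bl Rv)) (proj₂ Rv)))

  build∈trees : ∀ {f} → Tree f → build f ∈ trees N
  build∈trees {f} T = ∈-filter⁺ (isBinary? N)
    (candidates⁺ M _ λ i<M → let Rv = s≤s (s≤s z≤n) , s≤s i<M in pos T Rv , ≤-pred (below T Rv))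
    (All.applyUpTo⁺₁ id N λ {i} _ → bin (suc i))
    where
    len : length (build f) ≡ M
    len = length-applyUpTo _ M
    T′ = Tree-resp (λ Rv → sym (par-build f Rv)) T
    bin : ∀ u → length (children (build f) u) ≡ 0 ⊎ length (children (build f) u) ≡ 2
    bin u with node T′ u
    ... | inj₁ l           = inj₁ (cong length (leaf⁻ (build f) len l))
    ... | inj₂ (_ , _ , k) = inj₂ (kids⁻ (build f) len k)

  -- `children` is increasing, hence the head followed by `chainEnd` is the least child.
  children-first : ∀ t → length t ≡ M → ∀ {x} → R x → First (par t) x → ∃ λ xs → children t (par t x) ≡ x ∷ xs
  children-first t len {x} Rx f with children t (par t x) in eq | children-sorted t (par t x)
  ... | []     | _ with () ← subst (x ∈_) eq (children⁺ t len Rx refl)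
  children-first t len {x} Rx f | v ∷ vs | v< ∷ _ with subst (x ∈_) eq (children⁺ t len Rx refl)
  ... | here refl = vs , refl
  ... | there x∈  = let Rv , e = children⁻ t len {par t x} (subst (v ∈_) (sym eq) (here refl)) in
                    contradiction (f Rv e) (<⇒≱ (All.lookup v< x∈))

  first-child : ∀ t → length t ≡ M → ∀ {u x xs} → children t u ≡ x ∷ xs → R x × par t x ≡ u × First (par t) x
  first-child t len {u} {x} eq with children⁻ t len {u} {x} (subst (x ∈_) (sym eq) (here refl))
  ... | Rx , refl = Rx , refl , fst
    where
    fst : First (par t) x
    fst Rv e with subst (_ ∈_) eq (children⁺ t len Rv e) | subst Sorted eq (children-sorted t u)
    ... | here refl | _       = ≤-refl
    ... | there v∈  | x< ∷ _ = <⇒≤ (All.lookup x< v∈)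

  -- The leaf reached by `eoc`.

  module _ (t : List ℕ) (t∈ : t ∈ trees N) where
    private
      len = ∈-trees⇒length t∈
      T   = ∈-trees⇒tree t∈

    -- Each step spends one unit of fuel and raises the label by at least one, so `N ≤ u + f`
    -- persists. When the fuel is gone, `u` is at least `N` and therefore a leaf.
    chainEnd⁻ : ∀ f u → N ≤ u + f → MinChain (par t) u →
      Leaf (par t) (chainEnd f t u) × MinChain (par t) (chainEnd f t u)
    chainEnd⁻ zero u N≤u c = (λ Rv e → <⇒≱ (<-≤-trans (below T Rv) (proj₂ Rv))
        (subst (N ≤_) (trans (+-identityʳ u) (sym e)) N≤u)) , c
    chainEnd⁻ (suc f) u N≤ c with children t u in eq
    ... | []     = leaf⁺ t len eq , c
    ... | v ∷ vs with first-child t len {u} eq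
    ...   | Rv , refl , fst = chainEnd⁻ f v
              (≤-trans (subst (N ≤_) (+-suc _ f) N≤) (+-monoˡ-≤ f (below T Rv))) (step Rv fst c)

    eoc⁻ : ∀ {e} → eoc t ≡ e → Leaf (par t) e × MinChain (par t) e
    eoc⁻ refl = chainEnd⁻ (length t) 1 (s≤s (≤-reflexive (sym len))) root

    -- The computation passes through every vertex of the chain. The bound on the remaining fuel `f`
    -- keeps it positive at any vertex that has a child.
    chainEnd⁺ : ∀ {e} → MinChain (par t) e → ∃ λ f → eoc t ≡ chainEnd f t e × N ≤ f + e
    chainEnd⁺ root = length t , refl , ≤-reflexive (trans (cong suc (sym len)) (+-comm 1 (length t)))
    chainEnd⁺ {e} (step Re fst c) with chainEnd⁺ c
    ... | zero  , _ , N≤ = contradiction N≤ (<⇒≱ (<-≤-trans (below T Re) (proj₂ Re)))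
    ... | suc f , eq , N≤ = f , trans eq chain ,
            ≤-trans N≤ (≤-trans (≤-reflexive (sym (+-suc f _))) (+-monoʳ-≤ f (below T Re)))
      where
      chain : chainEnd (suc f) t (par t e) ≡ chainEnd f t e
      chain with children t (par t e) | children-first t len Re fst
      ... | .(e ∷ _) | _ , refl = refl

    eoc⁺ : ∀ {e} → Leaf (par t) e → MinChain (par t) e → eoc t ≡ e
    eoc⁺ {e} l c with chainEnd⁺ c
    ... | zero  , eq , _ = eq
    ... | suc f , eq , _ = trans eq chain
      where
      chain : chainEnd (suc f) t e ≡ e
      chain rewrite leaf⁻ t len l = refl

-- Exchange of two adjacent labels.

abstract
  -- Abstract, so that outside this block it is evaluated only through `swap-lo`, `swap-hi` and
  -- `swap-≢`.
  swap : ℕ → ℕ → ℕ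
  swap j v with v ≟ j
  ... | yes _ = suc j
  ... | no _ with v ≟ suc j
  ...   | yes _ = j
  ...   | no _  = v

  swap-lo : ∀ j → swap j j ≡ suc j
  swap-lo j with j ≟ j
  ... | yes _  = refl
  ... | no j≢j = contradiction refl j≢j

  swap-hi : ∀ j → swap j (suc j) ≡ j
  swap-hi j with suc j ≟ j
  ... | yes e = contradiction (sym e) (m≢1+n+m j {0})
  ... | no _ with suc j ≟ suc j
  ...   | yes _ = refl
  ...   | no ≢  = contradiction refl ≢

  swap-≢ : ∀ {j v} → v ≢ j → v ≢ suc j → swap j v ≡ v
  swap-≢ {j} {v} v≢j v≢sj with v ≟ j
  ... | yes e = contradiction e v≢j
  ... | no _ with v ≟ suc j
  ...   | yes e = contradiction e v≢sj
  ...   | no _  = refl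

swap-< : ∀ {j v} → v < j → swap j v ≡ v
swap-< v<j = swap-≢ (<⇒≢ v<j) (<⇒≢ (m<n⇒m<1+n v<j))

swap-> : ∀ {j v} → suc j < v → swap j v ≡ v
swap-> {j} j<v = swap-≢ (λ { refl → <⇒≱ j<v (n≤1+n j) }) (>⇒≢ j<v)

data SwapView (j : ℕ) : ℕ → Set where
  lo    : SwapView j j
  hi    : SwapView j (suc j)
  other : ∀ {v} → v ≢ j → v ≢ suc j → SwapView j v

swapView : ∀ j v → SwapView j v
swapView j v with v ≟ j | v ≟ suc j
... | yes refl | _        = lo
... | no _     | yes refl = hi
... | no p     | no q     = other p q

swap-invol : ∀ j v → swap j (swap j v) ≡ v
swap-invol j v with swapView j v
... | lo        rewrite swap-lo j = swap-hi j
... | hi        rewrite swap-hi j = swap-lo j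
... | other p q rewrite swap-≢ p q = swap-≢ p q

swap-injective : ∀ j {v w} → swap j v ≡ swap j w → v ≡ w
swap-injective j {v} {w} e = trans (sym (swap-invol j v)) (trans (cong (swap j) e) (swap-invol j w))

swap-adjoint : ∀ j {v w} → swap j v ≡ w → v ≡ swap j w
swap-adjoint j refl = sym (swap-invol j _)

swap-pos : ∀ {j v} → 1 ≤ j → 1 ≤ v → 1 ≤ swap j v
swap-pos {j} {v} 1≤j 1≤v with swapView j v
... | lo        rewrite swap-lo j = s≤s z≤n
... | hi        rewrite swap-hi j = 1≤j
... | other p q rewrite swap-≢ p q = 1≤v

-- No label lies between `j` and `suc j`, so every other label compares alike with both.
swap-mono-< : ∀ {j v w} → v < w → ¬ (v ≡ j × w ≡ suc j) → swap j v < swap j w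
swap-mono-< {j} {v} {w} v<w ¬jj with swapView j v | swapView j w
... | lo | lo = contradiction v<w (<-irrefl refl)
... | lo | hi = contradiction (refl , refl) ¬jj
... | hi | hi = contradiction v<w (<-irrefl refl)
... | hi | lo = contradiction v<w (<⇒≯ (n<1+n j))
... | lo | other p q rewrite swap-lo j | swap-≢ p q = ≤∧≢⇒< v<w (q ∘ sym)
... | hi | other p q rewrite swap-hi j | swap-≢ p q = <-trans (n<1+n j) v<w
... | other p q | lo rewrite swap-lo j | swap-≢ p q = m<n⇒m<1+n v<w
... | other p q | hi rewrite swap-hi j | swap-≢ p q = ≤∧≢⇒< (≤-pred v<w) p
... | other p q | other p′ q′ rewrite swap-≢ p q | swap-≢ p′ q′ = v<w

-- Transport of trees along permutations of labels.

module Moves (M : ℕ) where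
  open Labels M public

  no-three-siblings : ∀ {p x y z} → Tree p → R x → R y → R z → x < y → y < z → p x ≡ p y → p y ≡ p z → ⊥
  no-three-siblings {p} {x} {y} {z} T Rx Ry Rz x<y y<z e e′ with node T (p y)
  ... | inj₁ l = l Ry refl
  ... | inj₂ (v , w , kids _ _ _ _ _ only) with only Rx e | only Ry refl | only Rz (sym e′)
  ... | inj₁ refl | inj₁ refl | _         = <-irrefl refl x<y
  ... | inj₂ refl | inj₂ refl | _         = <-irrefl refl x<y
  ... | inj₁ refl | inj₂ refl | inj₁ refl = <-asym x<y y<z
  ... | inj₁ refl | inj₂ refl | inj₂ refl = <-irrefl refl y<z
  ... | inj₂ refl | inj₁ refl | inj₁ refl = <-irrefl refl y<z
  ... | inj₂ refl | inj₁ refl | inj₂ refl = <-asym x<y y<z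

  sibling : ∀ {p u x} → Node p u → R x → p x ≡ u → ∃ (Kids p u x)
  sibling (inj₁ l) Rx e = contradiction e (l Rx)
  sibling (inj₂ (v , w , K@(kids Rv Rw v≢w pv pw only))) Rx e with only Rx e
  ... | inj₁ refl = w , K
  ... | inj₂ refl = v , kids Rw Rv (v≢w ∘ sym) pw pv λ R e → [ inj₂ , inj₁ ]′ (only R e)

  Node-resp : ∀ {p p′ u} → (∀ {v} → R v → p v ≡ u → p′ v ≡ u) → (∀ {v} → R v → p′ v ≡ u → p v ≡ u) →
              Node p u → Node p′ u
  Node-resp to from (inj₁ l) = inj₁ λ Rv e → l Rv (from Rv e)
  Node-resp to from (inj₂ (x , y , kids Rx Ry x≢y px py only)) =
    inj₂ (x , y , kids Rx Ry x≢y (to Rx px) (to Ry py) λ Rv e → only Rv (from Rv e))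

  module _ (τ σ σ′ : ℕ → ℕ) (ττ : ∀ v → τ (τ v) ≡ v) (σσ′ : ∀ v → σ (σ′ v) ≡ v) (σ′σ : ∀ v → σ′ (σ v) ≡ v)
           (Rσ : ∀ {v} → R v → R (σ v)) (Rσ′ : ∀ {v} → R v → R (σ′ v)) (p : ℕ → ℕ) where
    private
      adj : ∀ {x u} → τ x ≡ u → x ≡ τ u
      adj refl = sym (ττ _)

    -- The new children of `u` are the images under `σ′` of the old children of `τ u`. Keeping `τ`
    -- and `σ` apart covers both a relabelling, where they coincide, and a permutation of subtrees.
    transport-node : (∀ u → Node p u) → ∀ u → Node (τ ∘ p ∘ σ) u
    transport-node nd u with nd (τ u)
    ... | inj₁ l = inj₁ λ Rv e → l (Rσ Rv) (adj e)
    ... | inj₂ (x , y , kids Rx Ry x≢y px py only) = inj₂ (σ′ x , σ′ y , kids (Rσ′ Rx) (Rσ′ Ry)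
            (λ e → x≢y (trans (sym (σσ′ x)) (trans (cong σ e) (σσ′ y)))) (back px) (back py) only′)
      where
      back : ∀ {x} → p x ≡ τ u → τ (p (σ (σ′ x))) ≡ u
      back {x} e = trans (cong (τ ∘ p) (σσ′ x)) (trans (cong τ e) (ττ u))
      only′ : ∀ {v} → R v → τ (p (σ v)) ≡ u → v ≡ σ′ x ⊎ v ≡ σ′ y
      only′ {v} Rv e with only (Rσ Rv) (adj e)
      ... | inj₁ e′ = inj₁ (trans (sym (σ′σ v)) (cong σ′ e′))
      ... | inj₂ e′ = inj₂ (trans (sym (σ′σ v)) (cong σ′ e′))

    transport-leaf : ∀ {u} → Leaf p u → Leaf (τ ∘ p ∘ σ) (τ u)
    transport-leaf l Rv e = l (Rσ Rv) (trans (adj e) (ττ _))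

  relabel : ℕ → (ℕ → ℕ) → ℕ → ℕ
  relabel j p v = swap j (p (swap j v))

  module Relabel {j : ℕ} (2≤j : 2 ≤ j) (j<N : suc j ≤ N) where

    swap-R : ∀ {v} → R v → R (swap j v)
    swap-R {v} Rv with swapView j v
    ... | lo        rewrite swap-lo j = m≤n⇒m≤1+n 2≤j , j<N
    ... | hi        rewrite swap-hi j = 2≤j , <⇒≤ j<N
    ... | other p q rewrite swap-≢ p q = Rv

    module _ {p : ℕ → ℕ} (T : Tree p) (¬pc : p (suc j) ≢ j) where

      -- The exchange could invert a parent and its child only for the pair `j`, `suc j`, which
      -- `¬pc` excludes.
      relabel-tree : Tree (relabel j p)
      relabel-tree = tree (λ Rv → swap-pos (<⇒≤ 2≤j) (pos T (swap-R Rv)))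
        (λ {v} Rv → subst (swap j (p (swap j v)) <_) (swap-invol j v)
          (swap-mono-< (below T (swap-R Rv)) λ { (e , e′) → ¬pc (trans (cong p (sym e′)) e) }))
        (transport-node (swap j) (swap j) (swap j) (swap-invol j) (swap-invol j) (swap-invol j) swap-R swap-R p (node T))

      relabel-leaf : ∀ {u} → Leaf p u → Leaf (relabel j p) (swap j u)
      relabel-leaf = transport-leaf (swap j) (swap j) (swap j) (swap-invol j) (swap-invol j) (swap-invol j) swap-R swap-R p

      -- A swap of adjacent labels reverses the order of siblings only if the two vertices are themselves siblings.
      relabel-minChain : p j ≢ p (suc j) → ∀ {x} → MinChain p x → MinChain (relabel j p) (swap j x)
      relabel-minChain ¬sib root = subst (MinChain (relabel j p)) (sym (swap-< 2≤j)) root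
      relabel-minChain ¬sib {x} (step Rx f c) = step (swap-R Rx) f′
          (subst (MinChain (relabel j p)) (cong (swap j ∘ p) (sym (swap-invol j x))) (relabel-minChain ¬sib c))
        where
        f′ : First (relabel j p) (swap j x)
        f′ {v} Rv e with m≤n⇒m<n∨m≡n (f (swap-R Rv) e′)
          where e′ = trans (swap-injective j e) (cong p (swap-invol j x))
        ... | inj₂ x≡ = ≤-reflexive (trans (cong (swap j) x≡) (swap-invol j v))
        ... | inj₁ x< = <⇒≤ (subst (swap j x <_) (swap-invol j v) (swap-mono-< x< λ { (refl , e₂) →
                ¬sib (trans (sym (trans (swap-injective j e) (cong p (swap-invol j x)))) (cong p e₂)) }))

-- Counting classes of trees with given chain end and parent of the maximum.

module Counts (M k : ℕ) (2≤N : 2 ≤ suc M) where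
  open Moves M public

  RN : R N
  RN = 2≤N , ≤-refl

  base? : ∀ e → Decidable (λ t → eoc t ≡ e × parentOf t N ≡ k)
  base? e t = (eoc t ≟ e) ×-dec (parentOf t N ≟ k)

  # : ℕ → {X : Pred (List ℕ) 0ℓ} → Decidable X → ℕ
  # e X? = length (filter (λ t → base? e t ×-dec X? t) (trees N))

  #-split : ∀ e {X Y : Pred (List ℕ) 0ℓ} (X? : Decidable X) (Y? : Decidable Y) →
    # e X? ≡ # e (λ t → X? t ×-dec Y? t) + # e (λ t → X? t ×-dec ¬? (Y? t))
  #-split e X? Y? = trans (count-split (λ t → base? e t ×-dec X? t) Y? (trees N)) (cong₂ _+_
    (count-bij _ _ trees! id id (λ { t t∈ ((b , x) , y) → t∈ , (b , x , y) , refl }) (λ { t t∈ (b , x , y) → t∈ , ((b , x) , y) , refl }))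
    (count-bij _ _ trees! id id (λ { t t∈ ((b , x) , y) → t∈ , (b , x , y) , refl }) (λ { t t∈ (b , x , y) → t∈ , ((b , x) , y) , refl })))

  -- What `base?` tests on a list, expressed for a parent function.
  record Ends (e : ℕ) (p : ℕ → ℕ) : Set where
    constructor ends
    field
      isTree : Tree p
      isLeaf : Leaf p e
      onChain : MinChain p e
      pN≡k   : p N ≡ k
  open Ends public

  toEnds : ∀ {e} t → t ∈ trees N → eoc t ≡ e → parentOf t N ≡ k → Ends e (par t)
  toEnds t t∈ e pk = let l , c = eoc⁻ t t∈ e in
    ends (∈-trees⇒tree t∈) l c (trans (sym (parentOf-par t (∈-trees⇒length t∈) RN)) pk)

  #-≡ : ∀ e {X Y : Pred (List ℕ) 0ℓ} (X? : Decidable X) (Y? : Decidable Y) →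
    (∀ t → t ∈ trees N → Ends e (par t) → X t → Y t) → (∀ t → t ∈ trees N → Ends e (par t) → Y t → X t) → # e X? ≡ # e Y?
  #-≡ e X? Y? to from = count-bij _ _ trees! id id
    (λ { t t∈ ((e , pk) , x) → t∈ , ((e , pk) , to t t∈ (toEnds t t∈ e pk) x) , refl })
    (λ { t t∈ ((e , pk) , y) → t∈ , ((e , pk) , from t t∈ (toEnds t t∈ e pk) y) , refl })

  -- One half of a bijection. The maps produce parent functions and `build` turns these into lists;
  -- since it keeps only the values on `R`, the inverse law is stated up to `Agree`.
  Image : (List ℕ → ℕ → ℕ) → (List ℕ → ℕ → ℕ) → ℕ → ℕ → Pred (List ℕ) 0ℓ → Pred (List ℕ) 0ℓ → Set
  Image F G e e′ X Y = ∀ t → t ∈ trees N → Ends e (par t) → X t →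
    Ends e′ (F t) × Y (build (F t)) × Agree (G (build (F t))) (par t)

  #-bij : ∀ {e e′} {X Y : Pred (List ℕ) 0ℓ} (X? : Decidable X) (Y? : Decidable Y) (F G : List ℕ → ℕ → ℕ) →
    Image F G e e′ X Y → Image G F e′ e Y X → # e X? ≡ # e′ Y?
  #-bij {e} {e′} {X} {Y} X? Y? F G FG GF =
    count-bij _ _ trees! (build ∘ F) (build ∘ G) (image {F} {G} {X = X} {Y} FG) (image {G} {F} {X = Y} {X} GF)
    where
    image : ∀ {F G e e′ X Y} → Image F G e e′ X Y → ∀ t → t ∈ trees N → (eoc t ≡ e × parentOf t N ≡ k) × X t →
      build (F t) ∈ trees N × ((eoc (build (F t)) ≡ e′ × parentOf (build (F t)) N ≡ k) × Y (build (F t))) ×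
      build (G (build (F t))) ≡ t
    image {F} {G} img t t∈ ((e , pk) , x) with img t t∈ (toEnds t t∈ e pk) x
    ... | ends T l′ c′ pk′ , y , ag = Ft∈ ,
        ((eoc⁺ (build (F t)) Ft∈ (λ Rv q → l′ Rv (trans (sym (par-build (F t) Rv)) q))
            (MinChain-agree T (λ Rv _ → sym (par-build (F t) Rv)) c′) ,
          trans (parentOf-par (build (F t)) (length-applyUpTo _ M) RN) (trans (par-build (F t) RN) pk′)) , y) ,
        build-par (G (build (F t))) (∈-trees⇒length t∈) ag
      where
      Ft∈ = build∈trees T

-- Exchanges as bijections between classes.

module Swaps (M k : ℕ) (2≤N : 2 ≤ suc M) where
  open Counts M k 2≤N public

  swap-data : ∀ {j e p} → 1 ≤ j → suc (suc j) ≤ N → k ≢ j → k ≢ suc j → Ends e p →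
    p (suc j) ≢ j → p j ≢ p (suc j) → 2 ≤ j × Ends (swap j e) (relabel j p)
  swap-data {j} {e} {p} 1≤j j<N k≢j k≢sj (ends T l c pN) ¬pc ¬sib = 2≤j ,
      ends (relabel-tree T ¬pc) (relabel-leaf T ¬pc l) (relabel-minChain T ¬pc ¬sib c)
           -- Both `N` and its parent `k` lie outside the exchanged pair.
           (trans (cong (swap j ∘ p) (swap-> j<N)) (trans (cong (swap j) pN) (swap-≢ k≢j k≢sj)))
    where
    Rsj : R (suc j)
    Rsj = s≤s 1≤j , <⇒≤ j<N
    2≤j : 2 ≤ j
    -- The parent of `suc j` is positive and, not being `j`, less than `j`; so `j` is not the root.
    2≤j = ≤-trans (s≤s (pos T Rsj)) (≤∧≢⇒< (≤-pred (below T Rsj)) ¬pc)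
    open Relabel 2≤j (<⇒≤ j<N)

  Swapped : ℕ → ℕ → (X Y : (ℕ → ℕ) → Set) → Set
  Swapped j e X Y = ∀ {t} → Ends e (par t) → X (par t) → par t (suc j) ≢ j × par t j ≢ par t (suc j) ×
    (2 ≤ j → ∀ {t′} → Agree (par t′) (relabel j (par t)) → Y (par t′))

  swap-count : ∀ {j e} → 1 ≤ j → suc (suc j) ≤ N → k ≢ j → k ≢ suc j →
    {X Y : (ℕ → ℕ) → Set} (X? : ∀ p → Dec (X p)) (Y? : ∀ p → Dec (Y p)) →
    Swapped j e X Y → Swapped j (swap j e) Y X →
    # e (X? ∘ par) ≡ # (swap j e) (Y? ∘ par)
  swap-count {j} {e} 1≤j j<N k≢j k≢sj {X} {Y} X? Y? XY YX =
    #-bij (X? ∘ par) (Y? ∘ par) (relabel j ∘ par) (relabel j ∘ par) (image {X = X} {Y} XY)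
      (λ t t∈ E x → let E′ , r = image {X = Y} {X} YX t t∈ E x in subst (λ e → Ends e _) (swap-invol j e) E′ , r)
    where
    image : ∀ {e X Y} → Swapped j e X Y →
      Image (relabel j ∘ par) (relabel j ∘ par) e (swap j e) (X ∘ par) (Y ∘ par)
    image sw t t∈ E x with sw {t} E x
    ... | ¬pc , ¬sib , y with swap-data 1≤j j<N k≢j k≢sj E ¬pc ¬sib
    ... | 2≤j , E′ = E′ , y 2≤j (par-build (relabel j (par t))) , λ {v} Rv →
          trans (cong (swap j) (par-build (relabel j (par t)) (swap-R Rv)))
            (trans (swap-invol j _) (cong (par t) (swap-invol j v)))
      where open Relabel 2≤j (<⇒≤ j<N)

-- Exchanges among three consecutive labels.

module Main (M k a : ℕ) (1≤a : 1 ≤ a) (c<N : 3 + a ≤ suc M)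
            (k≢a : k ≢ a) (k≢b : k ≢ suc a) (k≢c : k ≢ suc (suc a)) where

  open Swaps M k (≤-trans (m≤m+n 2 (suc a)) c<N) public

  b c : ℕ
  b = suc a
  c = suc b

  a<b : a < b
  a<b = n<1+n a
  b<c : b < c
  b<c = n<1+n b
  a<c : a < c
  a<c = <-trans a<b b<c

  Rb : R b
  Rb = s≤s 1≤a , <⇒≤ (<-trans b<c c<N)
  Rc : R c
  Rc = s≤s (m≤n⇒m≤1+n 1≤a) , <⇒≤ c<N

  -- Classes are described by the parents of `a`, `b`, `c`; in all conditions below these are `x`,
  -- `y`, `z` in this order.
  Cond : Set₁
  Cond = ℕ → ℕ → ℕ → Set

  ⟨_⟩ : Cond → (ℕ → ℕ) → Set
  ⟨ X ⟩ p = X (p a) (p b) (p c)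

  #₃ : ℕ → {X : Cond} → (∀ x y z → Dec (X x y z)) → ℕ
  #₃ e X? = # e (λ t → X? (par t a) (par t b) (par t c))

  par-a : ∀ t → R a ⊎ par t a ≡ 0
  par-a t with a ≟ 1
  ... | yes a≡1 = inj₂ (cong (par t) a≡1)
  ... | no  a≢1 = inj₁ (≤∧≢⇒< 1≤a (a≢1 ∘ sym) , ≤-trans (n≤1+n a) (proj₂ Rb))

  -- `a` may be the root, where `par` takes the default 0. Then `p a < a` still holds, and no vertex
  -- in `R` has parent 0, so a sibling of `a` in `R` forces `R a`.
  record At (e : ℕ) (p : ℕ → ℕ) : Set where
    constructor at-ends
    field
      E    : Ends e p
      Ra⊎0 : R a ⊎ p a ≡ 0
    treeOf = isTree E

    pa<a : p a < a
    pa<a = [ below treeOf , (λ e → subst (_< a) (sym e) 1≤a) ]′ Ra⊎0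

    sib⇒Ra : ∀ {v} → R v → p v ≡ p a → R a
    sib⇒Ra Rv e = [ id , (λ e′ → contradiction (trans e e′) (>⇒≢ (pos treeOf Rv))) ]′ Ra⊎0
  open At

  module SwapAB where
    Hyp : ℕ → Cond → Cond → Set
    Hyp e X Y = ∀ {p} → At e p → ⟨ X ⟩ p →
      p b ≢ a × p a ≢ p b × Y (swap a (p b)) (swap a (p a)) (swap a (p c))

    toSwapped : ∀ {e} X Y → Hyp e X Y → Swapped a e ⟨ X ⟩ ⟨ Y ⟩
    toSwapped X Y h {t} E x with h (at-ends E (par-a t)) x
    ... | ¬pc , ¬sib , y = ¬pc , ¬sib , λ 2≤a {t′} ag →
          let eqa = trans (ag (2≤a , ≤-trans (n≤1+n a) (proj₂ Rb))) (cong (swap a ∘ par t) (swap-lo a))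
              eqb = trans (ag Rb) (cong (swap a ∘ par t) (swap-hi a))
              eqc = trans (ag Rc) (cong (swap a ∘ par t) (swap-> b<c))
          in subst (λ z → Y z (par t′ b) (par t′ c)) (sym eqa)
               (subst₂ (Y _) (sym eqb) (sym eqc) y)

    count : ∀ {e e′ X Y} → swap a e ≡ e′ → (X? : ∀ x y z → Dec (X x y z)) (Y? : ∀ x y z → Dec (Y x y z)) →
      Hyp e X Y → Hyp e′ Y X → #₃ e X? ≡ #₃ e′ Y?
    count {e} {_} {X} {Y} refl X? Y? f g = swap-count {a} {e} 1≤a (<⇒≤ c<N) k≢a k≢b {⟨ X ⟩} {⟨ Y ⟩}
      (λ p → X? (p a) (p b) (p c)) (λ p → Y? (p a) (p b) (p c)) (toSwapped X Y f) (toSwapped Y X g)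

  module SwapBC where
    Hyp : ℕ → Cond → Cond → Set
    Hyp e X Y = ∀ {p} → At e p → ⟨ X ⟩ p →
      p c ≢ b × p b ≢ p c × Y (swap b (p a)) (swap b (p c)) (swap b (p b))

    toSwapped : ∀ {e} X Y → Hyp e X Y → Swapped b e ⟨ X ⟩ ⟨ Y ⟩
    toSwapped X Y h {t} E x with h (at-ends E (par-a t)) x
    ... | ¬pc , ¬sib , y = ¬pc , ¬sib , λ 2≤b {t′} ag →
          let eqb = trans (ag Rb) (cong (swap b ∘ par t) (swap-lo b))
              eqc = trans (ag Rc) (cong (swap b ∘ par t) (swap-hi b))
          in subst (λ z → Y z (par t′ b) (par t′ c)) (sym (eqa ag))
               (subst₂ (Y _) (sym eqb) (sym eqc) y)
      where
      eqa : ∀ {t′} → Agree (par t′) (relabel b (par t)) → par t′ a ≡ swap b (par t a)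
      eqa {t′} ag with a ≟ 1
      -- At the root both sides are the default 0, which `swap b` fixes; `Agree` says nothing there.
      ... | yes a≡1 = trans (cong (par t′) a≡1) (sym (trans (cong (swap b ∘ par t) a≡1) (swap-< {b} (s≤s z≤n))))
      ... | no  a≢1 = trans (ag (≤∧≢⇒< 1≤a (a≢1 ∘ sym) , ≤-trans (n≤1+n a) (proj₂ Rb)))
                         (cong (swap b ∘ par t) (swap-< a<b))

    count : ∀ {e e′ X Y} → swap b e ≡ e′ → (X? : ∀ x y z → Dec (X x y z)) (Y? : ∀ x y z → Dec (Y x y z)) →
      Hyp e X Y → Hyp e′ Y X → #₃ e X? ≡ #₃ e′ Y?
    count {e} {_} {X} {Y} refl X? Y? f g = swap-count {b} {e} (s≤s z≤n) c<N k≢b k≢c {⟨ X ⟩} {⟨ Y ⟩}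
      (λ p → X? (p a) (p b) (p c)) (λ p → Y? (p a) (p b) (p c)) (toSwapped X Y f) (toSwapped Y X g)

  swap-≢ᵃ : ∀ j {v w} → v ≢ swap j w → swap j v ≢ w
  swap-≢ᵃ j v≢ e = v≢ (swap-adjoint j e)

  swap-inj-≢ : ∀ j {v w} → v ≢ w → swap j v ≢ swap j w
  swap-inj-≢ j v≢w e = v≢w (swap-injective j e)

  no-smaller-sibling : ∀ {p x v} → MinChain p x → R x → R v → v < x → p v ≢ p x
  no-smaller-sibling c Rx Rv v<x e = <⇒≱ v<x (proj₁ (MinChain-inv (proj₁ Rx) c) Rv e)

  pa≢ : ∀ {e p x} → At e p → a ≤ x → p a ≢ x
  pa≢ A a≤x = <⇒≢ (<-≤-trans (pa<a A) a≤x)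

  swap-a≢ : ∀ {e p} → At e p → swap a (p a) ≢ a
  swap-a≢ A = swap-≢ᵃ a (λ e → pa≢ A (n≤1+n a) (trans e (swap-lo a)))

  no-smaller-a : ∀ {e p v} → At e p → MinChain p v → R v → a < v → p a ≢ p v
  no-smaller-a A c Rv a<v e = no-smaller-sibling c Rv (sib⇒Ra A Rv (sym e)) a<v e

  -- The remaining obstacles are automatic: the leaf `a` has no child `b`, and `b` on the chain has
  -- no smaller sibling `a`.
  swap-ab : #₃ a (λ x y z → ¬? (y ≟ x)) ≡ #₃ b (λ x y z → ¬? (y ≟ a))
  swap-ab = SwapAB.count (swap-lo a) (λ x y z → ¬? (y ≟ x)) (λ x y z → ¬? (y ≟ a))
    (λ A y≢x → isLeaf (E A) Rb , y≢x ∘ sym , swap-a≢ A)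
    (λ A y≢a → let ≢ = no-smaller-a A (onChain (E A)) Rb a<b in y≢a , ≢ , swap-inj-≢ a ≢)

  swap-bc : #₃ b (λ x y z → ¬? (z ≟ y)) ≡ #₃ c (λ x y z → ¬? (z ≟ b))
  swap-bc = SwapBC.count (swap-lo b) (λ x y z → ¬? (z ≟ y)) (λ x y z → ¬? (z ≟ b))
    (λ A z≢y → isLeaf (E A) Rc , z≢y ∘ sym ,
      swap-≢ᵃ b (λ e → <⇒≢ (<-trans (below (treeOf A) Rb) b<c) (trans e (swap-lo b))))
    (λ A z≢b → let ≢ = no-smaller-sibling (onChain (E A)) Rc Rb b<c in z≢b , ≢ , swap-inj-≢ b ≢)

  -- Exchanging `b` and `c` leads to the trees with `eoc = a` in which `c` is the sibling of `a`;
  -- exchanging `a` and `b` then makes `b` the chain end with sibling `c`.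
  sibling-pair : #₃ a (λ x y z → (y ≟ x) ×-dec ¬? (z ≟ b)) ≡ #₃ b (λ x y z → (z ≟ y) ×-dec ¬? (y ≟ a))
  sibling-pair = trans
    (SwapBC.count (swap-< a<b) (λ x y z → (y ≟ x) ×-dec ¬? (z ≟ b)) (λ x y z → z ≟ x) f₁ g₁)
    (SwapAB.count (swap-lo a) (λ x y z → z ≟ x) (λ x y z → (z ≟ y) ×-dec ¬? (y ≟ a)) f₂ g₂)
    where
    f₁ : SwapBC.Hyp a (λ x y z → y ≡ x × z ≢ b) (λ x y z → z ≡ x)
    f₁ A (y≡x , z≢b) = z≢b , no-three-siblings (treeOf A) (sib⇒Ra A Rb y≡x) Rb Rc a<b b<c (sym y≡x) , cong (swap b) y≡x
    g₁ : SwapBC.Hyp a (λ x y z → z ≡ x) (λ x y z → y ≡ x × z ≢ b)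
    g₁ A z≡x = (λ e → pa≢ A (<⇒≤ a<b) (trans (sym z≡x) e)) ,
      (λ e → no-three-siblings (treeOf A) (sib⇒Ra A Rc z≡x) Rb Rc a<b b<c (sym (trans e z≡x)) e) ,
      cong (swap b) z≡x , swap-≢ᵃ b (λ e → <⇒≢ (<-trans (below (treeOf A) Rb) b<c) (trans e (swap-lo b)))
    f₂ : SwapAB.Hyp a (λ x y z → z ≡ x) (λ x y z → z ≡ y × y ≢ a)
    f₂ A z≡x = isLeaf (E A) Rb ,
      (λ e → no-three-siblings (treeOf A) (sib⇒Ra A Rc z≡x) Rb Rc a<b b<c e (sym (trans z≡x e))) ,
      cong (swap a) z≡x , swap-a≢ A
    g₂ : SwapAB.Hyp b (λ x y z → z ≡ y × y ≢ a) (λ x y z → z ≡ x)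
    g₂ A (z≡y , y≢a) = y≢a , no-smaller-a A (onChain (E A)) Rb a<b , cong (swap a) z≡y

  -- Exchanging `a` and `b` turns the chain end `b, c` into `a, c`, with `a` and `b` not siblings;
  -- exchanging `b` and `c` turns it into `a, b`.
  parent-child : #₃ c (λ x y z → (z ≟ b) ×-dec ¬? (y ≟ a)) ≡ #₃ b (λ x y z → ((y ≟ a) ×-dec ¬? (z ≟ a)) ×-dec ¬? (z ≟ x))
  parent-child = trans
    (SwapAB.count (swap-> b<c) (λ x y z → (z ≟ b) ×-dec ¬? (y ≟ a)) (λ x y z → (z ≟ a) ×-dec ¬? (x ≟ y)) f₁ g₁)
    (SwapBC.count (swap-hi b) (λ x y z → (z ≟ a) ×-dec ¬? (x ≟ y)) (λ x y z → ((y ≟ a) ×-dec ¬? (z ≟ a)) ×-dec ¬? (z ≟ x)) f₂ g₂)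
    where
    sba : swap b a ≡ a
    sba = swap-< a<b
    f₁ : SwapAB.Hyp c (λ x y z → z ≡ b × y ≢ a) (λ x y z → z ≡ a × x ≢ y)
    f₁ A (z≡b , y≢a) = y≢a , ≢ , trans (cong (swap a) z≡b) (swap-hi a) , swap-inj-≢ a (≢ ∘ sym)
      where ≢ = no-smaller-a A (subst (MinChain _) z≡b (proj₂ (MinChain-inv (proj₁ Rc) (onChain (E A))))) Rb a<b
    g₁ : SwapAB.Hyp c (λ x y z → z ≡ a × x ≢ y) (λ x y z → z ≡ b × y ≢ a)
    g₁ A (z≡a , x≢y) = (λ e → no-smaller-sibling (onChain (E A)) Rc Rb b<c (trans e (sym z≡a))) , x≢y ,
      trans (cong (swap a) z≡a) (swap-lo a) , swap-a≢ A
    f₂ : SwapBC.Hyp c (λ x y z → z ≡ a × x ≢ y) (λ x y z → (y ≡ a × z ≢ a) × z ≢ x)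
    f₂ A (z≡a , x≢y) = (λ e → <⇒≢ a<b (trans (sym z≡a) e)) , ≢ ,
      (trans (cong (swap b) z≡a) sba , swap-≢ᵃ b (λ e → ≢ (trans e (trans sba (sym z≡a))))) , swap-inj-≢ b (x≢y ∘ sym)
      where ≢ = no-smaller-sibling (onChain (E A)) Rc Rb b<c
    g₂ : SwapBC.Hyp b (λ x y z → (y ≡ a × z ≢ a) × z ≢ x) (λ x y z → z ≡ a × x ≢ y)
    g₂ A ((y≡a , z≢a) , z≢x) = isLeaf (E A) Rc , (λ e → z≢a (trans (sym e) y≡a)) ,
      trans (cong (swap b) y≡a) sba , swap-inj-≢ b (z≢x ∘ sym)

  -- All children of `u` exceed `u`, so a child `suc u` is the least one.
  MinChain-suc : ∀ {p u} → Tree p → R (suc u) → p (suc u) ≡ u → MinChain p u → MinChain p (suc u)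
  MinChain-suc {p} T Rsu eq m = step Rsu (λ Rv e → subst (_< _) (trans e eq) (below T Rv)) (subst (MinChain p) (sym eq) m)

  -- Regrafting the subtrees at `a`, `b`, `c`.

  data Place (v : ℕ) : Set where
    at-a    : v ≡ a → Place v
    at-b    : v ≡ b → Place v
    at-c    : v ≡ c → Place v
    outside : v < a ⊎ c < v → Place v

  place : ∀ v → Place v
  place v with ≤-<-connex a v
  ... | inj₂ v<a = outside (inj₁ v<a)
  ... | inj₁ a≤v with m≤n⇒m<n∨m≡n a≤v
  ...   | inj₂ a≡v = at-a (sym a≡v)
  ...   | inj₁ b≤v with m≤n⇒m<n∨m≡n b≤v
  ...     | inj₂ b≡v = at-b (sym b≡v)
  ...     | inj₁ c≤v with m≤n⇒m<n∨m≡n c≤v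
  ...       | inj₂ c≡v = at-c (sym c≡v)
  ...       | inj₁ c<v = outside (inj₂ c<v)

  swap-outside : ∀ {v} → v < a ⊎ c < v → swap a v ≡ v × swap b v ≡ v
  swap-outside (inj₁ v<a) = swap-< v<a , swap-< (m<n⇒m<1+n v<a)
  swap-outside (inj₂ c<v) = swap-> (<-trans b<c c<v) , swap-> c<v

  -- Exchange the labels a and b, then permute by σ the subtrees hanging at a, b and c.
  module Surgery (σ σ′ : ℕ → ℕ) (σσ′ : ∀ v → σ (σ′ v) ≡ v) (σ′σ : ∀ v → σ′ (σ v) ≡ v)
                 (fixed : ∀ {v} → v < a ⊎ c < v → σ v ≡ v) (Rσ : ∀ {v} → R v → R (σ v)) (Rσ′ : ∀ {v} → R v → R (σ′ v))
                 {p : ℕ → ℕ} (T : Tree p) where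
    surgery : ℕ → ℕ
    surgery v = swap a (p (σ v))

    private
      under : ∀ {v} → R v → v < a → surgery v ≡ p v
      under Rv v<a = trans (cong (swap a ∘ p) (fixed (inj₁ v<a))) (swap-< (<-trans (below T Rv) v<a))

    surgery-tree : 1 ≤ surgery a × surgery a < a → 1 ≤ surgery b × surgery b < b → 1 ≤ surgery c × surgery c < c →
      Tree surgery
    surgery-tree fa fb fc = tree (proj₁ ∘ bounds) (proj₂ ∘ bounds)
        (transport-node (swap a) σ σ′ (swap-invol a) σσ′ σ′σ Rσ Rσ′ p (node T))
      where
      bounds : ∀ {v} → R v → 1 ≤ surgery v × surgery v < v
      bounds {v} Rv with place v
      ... | at-a refl = fa
      ... | at-b refl = fb
      ... | at-c refl = fc
      ... | outside (inj₁ v<a) = subst (λ z → 1 ≤ z × z < v) (sym (under Rv v<a)) (pos T Rv , below T Rv)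
      ... | outside (inj₂ c<v) = subst (λ z → 1 ≤ z × z < v) (sym (cong (swap a ∘ p) (fixed (inj₂ c<v))))
              (swap-pos 1≤a (pos T Rv) , subst (swap a (p v) <_) (proj₁ (swap-outside (inj₂ c<v)))
                (swap-mono-< (below T Rv) λ { (_ , e) → <⇒≢ (<-trans b<c c<v) (sym e) }))

    surgery-leaf : ∀ {u} → Leaf p u → Leaf surgery (swap a u)
    surgery-leaf = transport-leaf (swap a) σ σ′ (swap-invol a) σσ′ σ′σ Rσ Rσ′ p

    -- Labels below `a` and their parents are fixed by `σ` and `swap a`, so up to `a` only the
    -- parent of `a` itself has to be checked.
    surgery-minChain : surgery a ≡ p a → MinChain p a → MinChain surgery a
    surgery-minChain fa = MinChain-agree T agree
      where
      agree : ∀ {v} → R v → v ≤ a → p v ≡ surgery v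
      agree Rv v≤a with m≤n⇒m<n∨m≡n v≤a
      ... | inj₁ v<a  = sym (under Rv v<a)
      ... | inj₂ refl = sym fa

    surgery-N : p N ≡ k → surgery N ≡ k
    surgery-N pN = trans (cong (swap a ∘ p) (fixed (inj₂ c<N))) (trans (cong (swap a) pN) (swap-≢ k≢a k≢b))

    surgery-back : Agree (swap a ∘ par (build surgery) ∘ σ′) p
    surgery-back {v} Rv = trans (cong (swap a) (par-build surgery (Rσ′ Rv)))
      (trans (swap-invol a (p (σ (σ′ v)))) (cong p (σσ′ v)))

  -- `σ` sends `a, b, c` to `b, c, a`. With `q = p a`, the parents `q, q, b` of `a, b, c` become
  -- `q, a, q`: the other child of `b` passes to `a`, and the empty set of children of the leaf `a`
  -- passes to `b`.
  reattach : #₃ a (λ x y z → (y ≟ x) ×-dec (z ≟ b)) ≡ #₃ b (λ x y z → ((y ≟ a) ×-dec ¬? (z ≟ a)) ×-dec (z ≟ x))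
  reattach = #-bij {X = ⟨ (λ x y z → y ≡ x × z ≡ b) ⟩ ∘ par} {⟨ (λ x y z → (y ≡ a × z ≢ a) × z ≡ x) ⟩ ∘ par}
         _ _ (λ t v → swap a (par t (σ v))) (λ t v → swap a (par t (σ′ v))) imageF imageG
    where
    σ σ′ : ℕ → ℕ
    σ  v = swap a (swap b v)
    σ′ v = swap b (swap a v)
    σσ′ : ∀ v → σ (σ′ v) ≡ v
    σσ′ v = trans (cong (swap a) (swap-invol b (swap a v))) (swap-invol a v)
    σ′σ : ∀ v → σ′ (σ v) ≡ v
    σ′σ v = trans (cong (swap b) (swap-invol a (swap b v))) (swap-invol b v)
    σ-fixed : ∀ {v} → v < a ⊎ c < v → σ v ≡ v
    σ-fixed o = trans (cong (swap a) (proj₂ (swap-outside o))) (proj₁ (swap-outside o))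
    σ′-fixed : ∀ {v} → v < a ⊎ c < v → σ′ v ≡ v
    σ′-fixed o = trans (cong (swap b) (proj₁ (swap-outside o))) (proj₂ (swap-outside o))
    σa : σ a ≡ b
    σa = trans (cong (swap a) (swap-< a<b)) (swap-lo a)
    σb : σ b ≡ c
    σb = trans (cong (swap a) (swap-lo b)) (swap-> b<c)
    σc : σ c ≡ a
    σc = trans (cong (swap a) (swap-hi b)) (swap-hi a)
    σ′a : σ′ a ≡ c
    σ′a = trans (cong (swap b) (swap-lo a)) (swap-lo b)
    σ′b : σ′ b ≡ a
    σ′b = trans (cong (swap b) (swap-hi a)) (swap-< a<b)
    σ′c : σ′ c ≡ b
    σ′c = trans (cong (swap b) (swap-> b<c)) (swap-hi b)
    module _ (Ra : R a) where
      swapA-R : ∀ {v} → R v → R (swap a v)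
      swapA-R = Relabel.swap-R (proj₁ Ra) (proj₂ Rb)
      swapB-R : ∀ {v} → R v → R (swap b v)
      swapB-R = Relabel.swap-R (m≤n⇒m≤1+n (proj₁ Ra)) (proj₂ Rc)

    imageF : Image (λ t v → swap a (par t (σ v))) (λ t v → swap a (par t (σ′ v))) a b
      (⟨ (λ x y z → y ≡ x × z ≡ b) ⟩ ∘ par) (⟨ (λ x y z → (y ≡ a × z ≢ a) × z ≡ x) ⟩ ∘ par)
    imageF t t∈ En@(ends T l m pN) (y≡x , z≡b) =
      ends Tf (subst (Leaf surgery) (swap-lo a) (surgery-leaf l)) (MinChain-suc Tf Rb fb (surgery-minChain fa m)) (surgery-N pN) ,
      ((trans (par-build surgery Rb) fb , λ e → <⇒≢ (pa<a A) (trans (sym (trans (par-build surgery Rc) fc)) e)) ,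
        trans (par-build surgery Rc) (trans fc (sym (trans (par-build surgery Ra) fa)))) ,
      surgery-back
      where
      A  = at-ends En (par-a t)
      p  = par t
      Ra = sib⇒Ra A Rb y≡x
      open Surgery σ σ′ σσ′ σ′σ σ-fixed (swapA-R Ra ∘ swapB-R Ra) (swapB-R Ra ∘ swapA-R Ra) T
      fa : surgery a ≡ p a
      fa = trans (cong (swap a) (trans (cong p σa) y≡x)) (swap-< (pa<a A))
      fb : surgery b ≡ a
      fb = trans (cong (swap a) (trans (cong p σb) z≡b)) (swap-hi a)
      fc : surgery c ≡ p a
      fc = trans (cong (swap a ∘ p) σc) (swap-< (pa<a A))
      Tf = surgery-tree (subst (λ z → 1 ≤ z × z < a) (sym fa) (pos T Ra , pa<a A))
             (subst (λ z → 1 ≤ z × z < b) (sym fb) (1≤a , a<b))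
             (subst (λ z → 1 ≤ z × z < c) (sym fc) (pos T Ra , <-trans (pa<a A) a<c))

    imageG : Image (λ t v → swap a (par t (σ′ v))) (λ t v → swap a (par t (σ v))) b a
      (⟨ (λ x y z → (y ≡ a × z ≢ a) × z ≡ x) ⟩ ∘ par) (⟨ (λ x y z → y ≡ x × z ≡ b) ⟩ ∘ par)
    imageG t t∈ En@(ends T l m pN) ((y≡a , z≢a) , z≡x) =
      ends Tf (subst (Leaf surgery) (swap-hi a) (surgery-leaf l))
        (surgery-minChain fa (subst (MinChain p) y≡a (proj₂ (MinChain-inv (proj₁ Rb) m)))) (surgery-N pN) ,
      (trans (par-build surgery Rb) (trans fb (sym (trans (par-build surgery Ra) fa))) ,
        trans (par-build surgery Rc) fc) ,
      surgery-back
      where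
      A  = at-ends En (par-a t)
      p  = par t
      Ra = sib⇒Ra A Rc z≡x
      open Surgery σ′ σ σ′σ σσ′ σ′-fixed (swapB-R Ra ∘ swapA-R Ra) (swapA-R Ra ∘ swapB-R Ra) T
      fa : surgery a ≡ p a
      fa = trans (cong (swap a) (trans (cong p σ′a) z≡x)) (swap-< (pa<a A))
      fb : surgery b ≡ p a
      fb = trans (cong (swap a ∘ p) σ′b) (swap-< (pa<a A))
      fc : surgery c ≡ b
      fc = trans (cong (swap a) (trans (cong p σ′c) y≡a)) (swap-lo a)
      Tf = surgery-tree (subst (λ z → 1 ≤ z × z < a) (sym fa) (pos T Ra , pa<a A))
             (subst (λ z → 1 ≤ z × z < b) (sym fb) (pos T Ra , <-trans (pa<a A) a<b))
             (subst (λ z → 1 ≤ z × z < c) (sym fc) (s≤s z≤n , b<c))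

  a≢b : a ≢ b
  a≢b = <⇒≢ a<b
  b≢c : b ≢ c
  b≢c = <⇒≢ b<c
  a≢c : a ≢ c
  a≢c = <⇒≢ a<c

  -- Joining and cutting below `a`.

  data Join (p : ℕ → ℕ) (v : ℕ) : ℕ → Set where
    is-b  : v ≡ b → Join p v a
    is-c  : v ≡ c → Join p v a
    moved : v ≢ b → v ≢ c → p v ≡ a ⊎ p v ≡ b → Join p v c
    kept  : v ≢ b → v ≢ c → p v ≢ a → p v ≢ b → Join p v (p v)

  abstract
    -- a{b{c,y},w} with c a leaf becomes a{b,c{w,y}}; the order of w and y is lost, which is the factor 2.
    join : (ℕ → ℕ) → ℕ → ℕ
    join p v with v ≟ b
    ... | yes _ = a
    ... | no _ with v ≟ c
    ...   | yes _ = a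
    ...   | no _ with p v ≟ a
    ...     | yes _ = c
    ...     | no _ with p v ≟ b
    ...       | yes _ = c
    ...       | no _  = p v

    -- Indexed by the value: matching on it together with `join p v` yields both the branch and the
    -- result, although `join` is abstract. `cutView` does the same for `cut`.
    joinView : ∀ p v → Join p v (join p v)
    joinView p v with v ≟ b
    ... | yes e = is-b e
    ... | no v≢b with v ≟ c
    ...   | yes e = is-c e
    ...   | no v≢c with p v ≟ a
    ...     | yes e = moved v≢b v≢c (inj₁ e)
    ...     | no pv≢a with p v ≟ b
    ...       | yes e   = moved v≢b v≢c (inj₂ e)
    ...       | no pv≢b = kept v≢b v≢c pv≢a pv≢b

  join-b : ∀ p → join p b ≡ a
  join-b p with join p b | joinView p b
  ... | _ | is-b _ = refl
  ... | _ | is-c _ = refl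
  ... | _ | moved ≢ _ _  = contradiction refl ≢
  ... | _ | kept ≢ _ _ _ = contradiction refl ≢

  join-c : ∀ p → join p c ≡ a
  join-c p with join p c | joinView p c
  ... | _ | is-b _ = refl
  ... | _ | is-c _ = refl
  ... | _ | moved _ ≢ _  = contradiction refl ≢
  ... | _ | kept _ ≢ _ _ = contradiction refl ≢

  join-moved : ∀ {p v} → v ≢ b → v ≢ c → p v ≡ a ⊎ p v ≡ b → join p v ≡ c
  join-moved {p} {v} v≢b v≢c e with join p v | joinView p v
  ... | _ | is-b e′ = contradiction e′ v≢b
  ... | _ | is-c e′ = contradiction e′ v≢c
  ... | _ | moved _ _ _ = refl
  ... | _ | kept _ _ ≢a ≢b = [ (λ e → contradiction e ≢a) , (λ e → contradiction e ≢b) ]′ e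

  join-kept : ∀ {p v} → v ≢ b → v ≢ c → p v ≢ a → p v ≢ b → join p v ≡ p v
  join-kept {p} {v} v≢b v≢c ≢a ≢b with join p v | joinView p v
  ... | _ | is-b e = contradiction e v≢b
  ... | _ | is-c e = contradiction e v≢c
  ... | _ | moved _ _ e = [ (λ e → contradiction e ≢a) , (λ e → contradiction e ≢b) ]′ e
  ... | _ | kept _ _ _ _ = refl

  join-cong : ∀ {p p′ v} → p v ≡ p′ v → join p v ≡ join p′ v
  join-cong {p} {p′} {v} e with join p v | joinView p v
  ... | _ | is-b refl = sym (join-b p′)
  ... | _ | is-c refl = sym (join-c p′)
  ... | _ | moved v≢b v≢c (inj₁ e′) = sym (join-moved v≢b v≢c (inj₁ (trans (sym e) e′)))
  ... | _ | moved v≢b v≢c (inj₂ e′) = sym (join-moved v≢b v≢c (inj₂ (trans (sym e) e′)))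
  ... | _ | kept v≢b v≢c ≢a ≢b = trans e (sym (join-kept v≢b v≢c (≢a ∘ trans e) (≢b ∘ trans e)))

  data Cut (p : ℕ → ℕ) (w v : ℕ) : ℕ → Set where
    is-c   : v ≡ c → Cut p w v b
    kept   : v ≢ c → p v ≢ c → Cut p w v (p v)
    chosen : v ≢ c → p v ≡ c → v ≡ w → Cut p w v a
    left   : v ≢ c → p v ≡ c → v ≢ w → Cut p w v b

  abstract
    -- a{b,c{w,y}} with b a leaf becomes a{b{c,y},w}.
    cut : (ℕ → ℕ) → ℕ → ℕ → ℕ
    cut p w v with v ≟ c
    ... | yes _ = b
    ... | no _ with p v ≟ c
    ...   | no _ = p v
    ...   | yes _ with v ≟ w
    ...     | yes _ = a
    ...     | no _  = b

    cutView : ∀ p w v → Cut p w v (cut p w v)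
    cutView p w v with v ≟ c
    ... | yes e = is-c e
    ... | no v≢c with p v ≟ c
    ...   | no pv≢c = kept v≢c pv≢c
    ...   | yes e with v ≟ w
    ...     | yes v≡w = chosen v≢c e v≡w
    ...     | no v≢w  = left v≢c e v≢w

  cut-c : ∀ p w → cut p w c ≡ b
  cut-c p w with cut p w c | cutView p w c
  ... | _ | is-c _ = refl
  ... | _ | kept ≢ _ = contradiction refl ≢
  ... | _ | chosen ≢ _ _ = contradiction refl ≢
  ... | _ | left ≢ _ _ = contradiction refl ≢

  cut-kept : ∀ {p w v} → v ≢ c → p v ≢ c → cut p w v ≡ p v
  cut-kept {p} {w} {v} v≢c pv≢c with cut p w v | cutView p w v
  ... | _ | is-c e = contradiction e v≢c
  ... | _ | kept _ _ = refl
  ... | _ | chosen _ e _ = contradiction e pv≢c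
  ... | _ | left _ e _ = contradiction e pv≢c

  cut-chosen : ∀ {p w} → w ≢ c → p w ≡ c → cut p w w ≡ a
  cut-chosen {p} {w} w≢c pw with cut p w w | cutView p w w
  ... | _ | is-c e = contradiction e w≢c
  ... | _ | kept _ ≢ = contradiction pw ≢
  ... | _ | chosen _ _ _ = refl
  ... | _ | left _ _ ≢ = contradiction refl ≢

  cut-left : ∀ {p w v} → v ≢ c → p v ≡ c → v ≢ w → cut p w v ≡ b
  cut-left {p} {w} {v} v≢c pv v≢w with cut p w v | cutView p w v
  ... | _ | is-c e = contradiction e v≢c
  ... | _ | kept _ ≢ = contradiction pv ≢
  ... | _ | chosen _ _ e = contradiction e v≢w
  ... | _ | left _ _ _ = refl

  cut-cong : ∀ {p p′ w v} → p v ≡ p′ v → cut p w v ≡ cut p′ w v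
  cut-cong {p} {p′} {w} {v} e with cut p w v | cutView p w v
  ... | _ | is-c refl = sym (cut-c p′ w)
  ... | _ | kept v≢c ≢ = trans e (sym (cut-kept v≢c (≢ ∘ trans e)))
  ... | _ | chosen v≢c e′ refl = sym (cut-chosen v≢c (trans (sym e) e′))
  ... | _ | left v≢c e′ v≢w = sym (cut-left v≢c (trans (sym e) e′) v≢w)

  ≤a⇒≢b : ∀ {v} → v ≤ a → v ≢ b
  ≤a⇒≢b v≤a = <⇒≢ (s≤s v≤a)
  ≤a⇒≢c : ∀ {v} → v ≤ a → v ≢ c
  ≤a⇒≢c v≤a = <⇒≢ (m<n⇒m<1+n (s≤s v≤a))

  N≢b : N ≢ b
  N≢b = >⇒≢ (<-trans b<c c<N)
  N≢c : N ≢ c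
  N≢c = >⇒≢ c<N

  module Joined {p : ℕ → ℕ} (En : Ends c p) (pb : p b ≡ a) (pc : p c ≡ b) where
    private
      T = isTree En
      l = isLeaf En
    w y : ℕ
    -- In a{b{c,y},w}, `w` is the sibling of `b` and `y` that of `c`.
    w = proj₁ (sibling (node T a) Rb pb)
    y = proj₁ (sibling (node T b) Rc pc)
    module Kw = Kids (proj₂ (sibling (node T a) Rb pb)) renaming (Ry to Rw; py to pw; x≢y to b≢w)
    module Ky = Kids (proj₂ (sibling (node T b) Rc pc)) renaming (x≢y to c≢y)

    w≢c : w ≢ c
    w≢c e = a≢b (trans (sym Kw.pw) (trans (cong p e) pc))
    y≢b : y ≢ b
    y≢b e = a≢b (sym (trans (sym Ky.py) (trans (cong p e) pb)))
    w≢y : w ≢ y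
    w≢y e = a≢b (trans (sym Kw.pw) (trans (cong p e) Ky.py))

    -- `c` was a leaf, so its children are exactly those handed over: `w` from `a` and `y` from `b`.
    join-kids : Kids (join p) c w y
    join-kids = kids Kw.Rw Ky.Ry w≢y (join-moved (Kw.b≢w ∘ sym) w≢c (inj₁ Kw.pw))
      (join-moved y≢b (Ky.c≢y ∘ sym) (inj₂ Ky.py)) only
      where
      only : ∀ {v} → R v → join p v ≡ c → v ≡ w ⊎ v ≡ y
      only {v} Rv e with join p v | joinView p v
      ... | _ | is-b _ = contradiction e a≢c
      ... | _ | is-c _ = contradiction e a≢c
      ... | _ | kept _ _ _ _ = contradiction e (l Rv)
      ... | _ | moved v≢b _ (inj₁ pv) = [ (λ e → contradiction e v≢b) , inj₁ ]′ (Kw.only Rv pv)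
      ... | _ | moved _ v≢c (inj₂ pv) = [ (λ e → contradiction e v≢c) , inj₂ ]′ (Ky.only Rv pv)

    join-leaf : Leaf (join p) b
    join-leaf {v} Rv e with join p v | joinView p v
    ... | _ | is-b _ = a≢b e
    ... | _ | is-c _ = a≢b e
    ... | _ | moved _ _ _ = b≢c (sym e)
    ... | _ | kept _ _ _ ≢b = ≢b e

    -- Parents of labels up to `a` do not change, so the chain still reaches `a`; it continues to
    -- `b = suc a`, now a leaf.
    join-ends : Ends b (join p)
    join-ends = ends Tj join-leaf
        (MinChain-suc Tj Rb (join-b p) (MinChain-agree T agree (subst (MinChain p) pb (proj₂ (MinChain-inv (proj₁ Rb)
          (subst (MinChain p) pc (proj₂ (MinChain-inv (proj₁ Rc) (onChain En)))))))))
        (trans (join-kept N≢b N≢c (k≢a ∘ trans (sym (pN≡k En))) (k≢b ∘ trans (sym (pN≡k En)))) (pN≡k En))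
      where
      agree : ∀ {v} → R v → v ≤ a → p v ≡ join p v
      agree Rv v≤a = sym (join-kept (≤a⇒≢b v≤a) (≤a⇒≢c v≤a)
        (<⇒≢ (<-≤-trans (below T Rv) v≤a)) (≤a⇒≢b (≤-trans (<⇒≤ (below T Rv)) v≤a)))
      -- A child of `a` or `b` is at least `b`; being neither `b` nor `c`, it exceeds `c` and may
      -- hang below it.
      beyond : ∀ {v} → R v → v ≢ b → v ≢ c → p v ≡ a ⊎ p v ≡ b → c < v
      beyond Rv v≢b v≢c e = ≤∧≢⇒< (≤∧≢⇒< ([ (λ e → subst (_< _) e (below T Rv)) ,
        (λ e → <⇒≤ (subst (_< _) e (below T Rv))) ]′ e) (v≢b ∘ sym)) (v≢c ∘ sym)
      bounds : ∀ {v} → R v → 1 ≤ join p v × join p v < v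
      bounds {v} Rv with join p v | joinView p v
      ... | _ | is-b e = 1≤a , subst (a <_) (sym e) a<b
      ... | _ | is-c e = 1≤a , subst (a <_) (sym e) a<c
      ... | _ | moved v≢b v≢c e = s≤s z≤n , beyond Rv v≢b v≢c e
      ... | _ | kept _ _ _ _ = pos T Rv , below T Rv
      onlyA : ∀ {v} → R v → join p v ≡ a → v ≡ b ⊎ v ≡ c
      onlyA {v} Rv e with join p v | joinView p v
      ... | _ | is-b e′ = inj₁ e′
      ... | _ | is-c e′ = inj₂ e′
      ... | _ | moved _ _ _ = contradiction (sym e) a≢c
      ... | _ | kept _ _ ≢a _ = contradiction e ≢a
      nd : ∀ u → Node (join p) u
      nd u with u ≟ a | u ≟ b | u ≟ c
      ... | yes refl | _ | _ = inj₂ (b , c , kids Rb Rc b≢c (join-b p) (join-c p) onlyA)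
      ... | no _ | yes refl | _ = inj₁ join-leaf
      ... | no _ | no _ | yes refl = inj₂ (w , y , join-kids)
      ... | no u≢a | no u≢b | no u≢c = Node-resp to from (node T u)
        where
        to : ∀ {v} → R v → p v ≡ u → join p v ≡ u
        to Rv refl = join-kept (λ e → u≢a (trans (cong p e) pb)) (λ e → u≢b (trans (cong p e) pc)) u≢a u≢b
        from : ∀ {v} → R v → join p v ≡ u → p v ≡ u
        from {v} Rv e with join p v | joinView p v
        ... | _ | is-b _ = contradiction (sym e) u≢a
        ... | _ | is-c _ = contradiction (sym e) u≢a
        ... | _ | moved _ _ _ = contradiction (sym e) u≢c
        ... | _ | kept _ _ _ _ = e
      Tj : Tree (join p)
      Tj = tree (proj₁ ∘ bounds) (proj₂ ∘ bounds) nd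

    -- Choosing `w` records which child of `c` came from `a`; the other one goes back to `b`.
    cut-join : Agree (cut (join p) w) p
    cut-join {v} Rv with toSum (v ≟ b) | toSum (v ≟ c)
    ... | inj₁ refl | _ = trans (cut-kept b≢c (a≢c ∘ trans (sym (join-b p)))) (trans (join-b p) (sym pb))
    ... | inj₂ _    | inj₁ refl = trans (cut-c (join p) w) (sym pc)
    ... | inj₂ v≢b  | inj₂ v≢c with toSum (p v ≟ a) | toSum (p v ≟ b)
    ...   | inj₂ ≢a | inj₂ ≢b = let jk = join-kept v≢b v≢c ≢a ≢b in trans (cut-kept v≢c (l Rv ∘ trans (sym jk))) jk
    ...   | inj₂ _  | inj₁ e  = trans (cut-left v≢c (join-moved v≢b v≢c (inj₂ e)) (λ v≡w →
              a≢b (trans (sym Kw.pw) (trans (cong p (sym v≡w)) e)))) (sym e)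
    ...   | inj₁ e  | _ with Kw.only Rv e
    ...     | inj₁ v≡b  = contradiction v≡b v≢b
    ...     | inj₂ refl = trans (cut-chosen v≢c (join-moved v≢b v≢c (inj₁ e))) (sym e)

  module Sliced {p : ℕ → ℕ} (En : Ends b p) (pb : p b ≡ a) (pc : p c ≡ a) {w y : ℕ} (K : Kids p c w y) where
    private
      T = isTree En
      l = isLeaf En
    open Kids K renaming (Rx to Rw; px to pw; x≢y to w≢y)

    w≢c : w ≢ c
    w≢c e = a≢c (trans (sym pc) (trans (cong p (sym e)) pw))
    y≢c : y ≢ c
    y≢c e = a≢c (trans (sym pc) (trans (cong p (sym e)) py))

    cut-b : cut p w b ≡ a
    cut-b = trans (cut-kept b≢c (a≢c ∘ trans (sym pb))) pb

    cut-w : cut p w w ≡ a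
    cut-w = cut-chosen w≢c pw

    only-bc : ∀ {v} → R v → p v ≡ a → v ≡ b ⊎ v ≡ c
    only-bc Rv e with sibling (node T a) Rb pb
    ... | x , kids _ _ _ _ _ onlyA with onlyA Rc pc | onlyA Rv e
    ... | inj₁ c≡b | _        = contradiction (sym c≡b) b≢c
    ... | inj₂ c≡x | inj₁ v≡b = inj₁ v≡b
    ... | inj₂ c≡x | inj₂ v≡x = inj₂ (trans v≡x (sym c≡x))

    -- Above `a` the chain is untouched, and below it runs through `b` and `c`, each the successor
    -- of its parent. `c` has given both children away and is a leaf.
    cut-ends : Ends c (cut p w)
    cut-ends = ends Tc leaf (MinChain-suc Tc Rc (cut-c p w) (MinChain-suc Tc Rb cut-b
        (MinChain-agree T agree (subst (MinChain p) pb (proj₂ (MinChain-inv (proj₁ Rb) (onChain En)))))))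
        (trans (cut-kept N≢c (k≢c ∘ trans (sym (pN≡k En)))) (pN≡k En))
      where
      agree : ∀ {v} → R v → v ≤ a → p v ≡ cut p w v
      agree Rv v≤a = sym (cut-kept (≤a⇒≢c v≤a) (≤a⇒≢c (≤-trans (<⇒≤ (below T Rv)) v≤a)))
      leaf : Leaf (cut p w) c
      leaf {v} Rv e with cut p w v | cutView p w v
      ... | _ | is-c _ = b≢c e
      ... | _ | kept _ ≢ = ≢ e
      ... | _ | chosen _ _ _ = a≢c e
      ... | _ | left _ _ _ = b≢c e
      bounds : ∀ {v} → R v → 1 ≤ cut p w v × cut p w v < v
      bounds {v} Rv with cut p w v | cutView p w v
      ... | _ | is-c e = s≤s z≤n , subst (b <_) (sym e) b<c
      ... | _ | kept _ _ = pos T Rv , below T Rv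
      ... | _ | chosen _ e _ = 1≤a , <-trans a<c (subst (_< v) e (below T Rv))
      ... | _ | left _ e _ = s≤s z≤n , <-trans b<c (subst (_< v) e (below T Rv))
      onlyA : ∀ {v} → R v → cut p w v ≡ a → v ≡ b ⊎ v ≡ w
      onlyA {v} Rv e with cut p w v | cutView p w v
      ... | _ | is-c _ = contradiction (sym e) a≢b
      ... | _ | kept v≢c _ = [ inj₁ , (λ e → contradiction e v≢c) ]′ (only-bc Rv e)
      ... | _ | chosen _ _ v≡w = inj₂ v≡w
      ... | _ | left _ _ _ = contradiction (sym e) a≢b
      onlyB : ∀ {v} → R v → cut p w v ≡ b → v ≡ c ⊎ v ≡ y
      onlyB {v} Rv e with cut p w v | cutView p w v
      ... | _ | is-c v≡c = inj₁ v≡c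
      ... | _ | kept _ _ = contradiction e (l Rv)
      ... | _ | chosen _ _ _ = contradiction e a≢b
      ... | _ | left _ pv v≢w = [ (λ e → contradiction e v≢w) , inj₂ ]′ (only Rv pv)
      b≢w : b ≢ w
      b≢w e = a≢c (trans (sym pb) (trans (cong p e) pw))
      nd : ∀ u → Node (cut p w) u
      nd u with u ≟ a | u ≟ b | u ≟ c
      ... | yes refl | _ | _ = inj₂ (b , w , kids Rb Rw b≢w cut-b cut-w onlyA)
      ... | no _ | yes refl | _ = inj₂ (c , y , kids Rc Ry (y≢c ∘ sym) (cut-c p w) (cut-left y≢c py (w≢y ∘ sym)) onlyB)
      ... | no _ | no _ | yes refl = inj₁ leaf
      ... | no u≢a | no u≢b | no u≢c = Node-resp to from (node T u)
        where
        to : ∀ {v} → R v → p v ≡ u → cut p w v ≡ u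
        to Rv refl = cut-kept (λ e → u≢a (trans (cong p e) pc)) u≢c
        from : ∀ {v} → R v → cut p w v ≡ u → p v ≡ u
        from {v} Rv e with cut p w v | cutView p w v
        ... | _ | is-c _ = contradiction (sym e) u≢b
        ... | _ | kept _ _ = e
        ... | _ | chosen _ _ _ = contradiction (sym e) u≢a
        ... | _ | left _ _ _ = contradiction (sym e) u≢b
      Tc : Tree (cut p w)
      Tc = tree (proj₁ ∘ bounds) (proj₂ ∘ bounds) nd

    join-cut : Agree (join (cut p w)) p
    join-cut {v} Rv with toSum (v ≟ b) | toSum (v ≟ c)
    ... | inj₁ refl | _ = trans (join-b (cut p w)) (sym pb)
    ... | inj₂ _    | inj₁ refl = trans (join-c (cut p w)) (sym pc)
    ... | inj₂ v≢b  | inj₂ v≢c with toSum (p v ≟ c) | toSum (v ≟ w)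
    ...   | inj₂ ≢c | _ = let ck = cut-kept v≢c ≢c in
              trans (join-kept v≢b v≢c (λ e → [ v≢b , v≢c ]′ (only-bc Rv (trans (sym ck) e))) (l Rv ∘ trans (sym ck))) ck
    ...   | inj₁ e  | inj₁ refl = trans (join-moved v≢b v≢c (inj₁ cut-w)) (sym e)
    ...   | inj₁ e  | inj₂ v≢w  = trans (join-moved v≢b v≢c (inj₂ (cut-left v≢c e v≢w))) (sym e)

  -- The factor two and the trees counted by `h`.

  children-pair : ∀ t → length t ≡ M → ∀ {u x y} → Kids (par t) u x y → ∃₂ λ v w → children t u ≡ v ∷ w ∷ []
  children-pair t len {u} K with children t u | kids⁻ t len K
  ... | v ∷ w ∷ [] | _ = v , w , refl

  nonleaf-kids : ∀ t → length t ≡ M → Tree (par t) → ∀ {u} → children t u ≢ [] → ∃₂ (Kids (par t) u)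
  nonleaf-kids t len T {u} ne with node T u
  ... | inj₁ l = contradiction (leaf⁻ t len l) ne
  ... | inj₂ K = K

  -- The two ways to choose `w` among the children of `c`, smaller or larger.
  first second : List ℕ → ℕ
  first (x ∷ _) = x
  first []      = 0
  second (_ ∷ y ∷ _) = y
  second _           = 0

  built : ∀ f {u x y} → Kids f u x y → Kids (par (build f)) u x y
  built f (kids Rx Ry x≢y px py only) = kids Rx Ry x≢y (trans (par-build f Rx) px) (trans (par-build f Ry) py)
    λ Rv e → only Rv (trans (sym (par-build f Rv)) e)

  c-leaf? : Decidable (λ t → children t c ≡ [])
  c-leaf? t = list-≡-dec _≟_ (children t c) []

  nested? : Decidable (λ t → par t c ≡ b × par t b ≡ a)
  nested? t = (par t c ≟ b) ×-dec (par t b ≟ a)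

  bc-under-a? : Decidable (λ t → par t b ≡ a × par t c ≡ a)
  bc-under-a? t = (par t b ≟ a) ×-dec (par t c ≟ a)

  joined : List ℕ → List ℕ
  joined t = children (build (join (par t))) c

  module Choice (sel : List ℕ → ℕ) (sel-ok : ∀ x y → sel (x ∷ y ∷ []) ≡ x ⊎ sel (x ∷ y ∷ []) ≡ y) where

    selected : ∀ t → length t ≡ M → ∀ {x y} → Kids (par t) c x y → ∃ (Kids (par t) c (sel (children t c)))
    selected t len K with children-pair t len K
    ... | x , y , eq with kids⁺ t len eq | sel-ok x y
    ...   | K′ | inj₁ e = subst (λ s → ∃ (Kids (par t) c s)) (sym (trans (cong sel eq) e)) (y , K′)
    ...   | K′ | inj₂ e = subst (λ s → ∃ (Kids (par t) c s)) (sym (trans (cong sel eq) e))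
                            (sibling (inj₂ (x , y , K′)) (Kids.Ry K′) (Kids.py K′))

    -- A nested tree is a joined tree with a choice of `w`. Fixing the choice to the selected child,
    -- recognized in `t` by its parent `a`, makes `join` a bijection with inverse `cut`.
    count : # c (λ t → nested? t ×-dec (par t (sel (joined t)) ≟ a)) ≡ # b (λ t → bc-under-a? t ×-dec ¬? (c-leaf? t))
    count = #-bij {X = X} {Y} _ _ (join ∘ par) (λ t → cut (par t) (sel (children t c))) imageF imageG
      where
      X Y : Pred (List ℕ) 0ℓ
      X t = (par t c ≡ b × par t b ≡ a) × par t (sel (joined t)) ≡ a
      Y t = (par t b ≡ a × par t c ≡ a) × children t c ≢ []
      imageF : Image (join ∘ par) (λ t → cut (par t) (sel (children t c))) c b X Y
      imageF t t∈ En ((pc , pb) , ps) = join-ends ,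
          ((trans (par-build f Rb) (join-b p) , trans (par-build f Rc) (join-c p)) , nonempty) ,
          λ {v} Rv → trans (cut-cong {w = s} (par-build f Rv)) (trans (cong (λ w → cut f w v) s≡w) (cut-join Rv))
        where
        open Joined En pb pc
        p = par t
        f = join p
        s = sel (joined t)
        len : length (build f) ≡ M
        len = length-applyUpTo _ M
        nonempty : children (build f) c ≢ []
        nonempty eq = leaf⁺ (build f) len eq Kw.Rw (Kids.px (built f join-kids))
        s≡w : s ≡ w
        -- The selected child is `w` or `y`, and `y` has parent `b` in `t`, not `a`.
        s≡w = let K = proj₂ (selected (build f) len (built f join-kids)) in
          [ id , (λ s≡y → contradiction (trans (sym ps) (trans (cong p s≡y) Ky.py)) a≢b) ]′
            (Kids.only join-kids (Kids.Rx K) (trans (sym (par-build f (Kids.Rx K))) (Kids.px K)))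
      imageG : Image (λ t → cut (par t) (sel (children t c))) (join ∘ par) b c Y X
      imageG t t∈ En ((pb , pc) , ne) = cut-ends ,
          ((trans (par-build f Rc) (cut-c p s) , trans (par-build f Rb) cut-b) ,
            subst (λ t → par (build f) (sel (children t c)) ≡ a) (sym back) (trans (par-build f (Kids.Rx K)) cut-w)) ,
          agree
        where
        p = par t
        s = sel (children t c)
        f = cut p s
        len = ∈-trees⇒length t∈
        K = proj₂ (selected t len (proj₂ (proj₂ (nonleaf-kids t len (isTree En) ne))))
        open Sliced En pb pc K
        agree : Agree (join (par (build f))) p
        agree Rv = trans (join-cong (par-build f Rv)) (join-cut Rv)
        -- Joining the cut tree returns the list `t`, so the selection made there is again `s`.
        back : build (join (par (build f))) ≡ t
        back = build-par _ (∈-trees⇒length t∈) agree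

  -- Exactly one of the two children of `c` in the joined tree is `w`: either the first, or else the
  -- second.
  nested≡2·cherry : # c nested? ≡ # b (λ t → bc-under-a? t ×-dec ¬? (c-leaf? t)) + # b (λ t → bc-under-a? t ×-dec ¬? (c-leaf? t))
  nested≡2·cherry = trans (#-split c nested? (λ t → par t (first (joined t)) ≟ a)) (cong₂ _+_
    (Choice.count first (λ _ _ → inj₁ refl))
    (trans (#-≡ c _ _ to from) (Choice.count second (λ _ _ → inj₂ refl))))
    where
    one : ∀ {t} → Ends c (par t) → par t c ≡ b → par t b ≡ a →
      (par t (first (joined t)) ≢ a → par t (second (joined t)) ≡ a) ×
      (par t (second (joined t)) ≡ a → par t (first (joined t)) ≢ a)
    one {t} En pc pb with children-pair (build (join (par t))) (length-applyUpTo _ M) (built _ (Joined.join-kids En pb pc))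
    ... | x , z , eq rewrite eq with kids⁺ (build (join (par t))) (length-applyUpTo _ M) eq
    ... | kids Rx Rz x≢z px pz _ = cases
      where
      open Joined En pb pc
      only′ : ∀ {v} → R v → par (build (join (par t))) v ≡ c → v ≡ w ⊎ v ≡ y
      only′ Rv e = Kids.only join-kids Rv (trans (sym (par-build (join (par t)) Rv)) e)
      cases : (par t x ≢ a → par t z ≡ a) × (par t z ≡ a → par t x ≢ a)
      cases with only′ Rx px | only′ Rz pz
      ... | inj₁ refl | inj₁ refl = contradiction refl x≢z
      ... | inj₂ refl | inj₂ refl = contradiction refl x≢z
      ... | inj₁ refl | inj₂ refl = (λ ≢ → contradiction Kw.pw ≢) , (λ e → contradiction (trans (sym e) Ky.py) a≢b)
      ... | inj₂ refl | inj₁ refl = (λ _ → Kw.pw) , (λ _ e → a≢b (trans (sym e) Ky.py))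
    to : ∀ t → t ∈ trees N → Ends c (par t) →
      (par t c ≡ b × par t b ≡ a) × par t (first (joined t)) ≢ a → (par t c ≡ b × par t b ≡ a) × par t (second (joined t)) ≡ a
    to t _ En ((pc , pb) , ≢) = (pc , pb) , proj₁ (one {t} En pc pb) ≢
    from : ∀ t → t ∈ trees N → Ends c (par t) →
      (par t c ≡ b × par t b ≡ a) × par t (second (joined t)) ≡ a → (par t c ≡ b × par t b ≡ a) × par t (first (joined t)) ≢ a
    from t _ En ((pc , pb) , e) = (pc , pb) , proj₂ (one {t} En pc pb) e

  -- `eoc = b` already makes `b` a leaf, and sortedness determines the list of children of `a` once
  -- `b` and `c` belong to it.
  h≡cherry-leaf : # (a + 1) (hCond? a) ≡ # b (λ t → bc-under-a? t ×-dec c-leaf? t)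
  h≡cherry-leaf = trans (cong (λ e → # e (hCond? a)) (+-comm a 1)) (#-≡ b (hCond? a) _ to from)
    where
    to : ∀ t → t ∈ trees N → Ends b (par t) → HCond a t → (par t b ≡ a × par t c ≡ a) × children t c ≡ []
    to t t∈ En H with subst₂ (λ b c → children t a ≡ b ∷ c ∷ [] × children t b ≡ [] × children t c ≡ []) (+-comm a 1) (+-comm a 2) H
    ... | eq , _ , eq′ = let K = kids⁺ t (∈-trees⇒length t∈) eq in (Kids.px K , Kids.py K) , eq′
    pair : ∀ {x y} → Sorted (x ∷ y ∷ []) → b ∈ x ∷ y ∷ [] → c ∈ x ∷ y ∷ [] → x ∷ y ∷ [] ≡ b ∷ c ∷ []
    pair _ (here refl) (here e) = contradiction (sym e) b≢c
    pair _ (here refl) (there (here refl)) = refl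
    pair ((x<y ∷ _) ∷ _) (there (here refl)) (here refl) = contradiction x<y (<⇒≯ b<c)
    pair _ (there (here refl)) (there (here e)) = contradiction (sym e) b≢c
    from : ∀ t → t ∈ trees N → Ends b (par t) → (par t b ≡ a × par t c ≡ a) × children t c ≡ [] → HCond a t
    from t t∈ En ((pb , pc) , eq) = subst₂ (λ b c → children t a ≡ b ∷ c ∷ [] × children t b ≡ [] × children t c ≡ [])
        (sym (+-comm a 1)) (sym (+-comm a 2)) (siblings , leaf⁻ t len (isLeaf En) , eq)
      where
      len = ∈-trees⇒length t∈
      siblings : children t a ≡ b ∷ c ∷ []
      siblings with children-pair t len (proj₂ (sibling (node (isTree En) a) Rb pb))
      ... | x , y , eq′ = trans eq′ (pair (subst Sorted eq′ (children-sorted t a))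
              (subst (b ∈_) eq′ (children⁺ t len Rb pb)) (subst (c ∈_) eq′ (children⁺ t len Rc pc)))

  -- Assembling the second difference.

  total : ℕ → ℕ
  total e = length (filter (base? e) (trees N))

  total-split : ∀ e {X : Cond} (X? : ∀ x y z → Dec (X x y z)) → total e ≡ #₃ e X? + #₃ e (λ x y z → ¬? (X? x y z))
  total-split e X? = count-split (base? e) (λ t → X? (par t a) (par t b) (par t c)) (trees N)

  #₃-split : ∀ e {X Y : Cond} (X? : ∀ x y z → Dec (X x y z)) (Y? : ∀ x y z → Dec (Y x y z)) →
    #₃ e X? ≡ #₃ e (λ x y z → X? x y z ×-dec Y? x y z) + #₃ e (λ x y z → X? x y z ×-dec ¬? (Y? x y z))
  #₃-split e X? Y? = #-split e (λ t → X? (par t a) (par t b) (par t c)) (λ t → Y? (par t a) (par t b) (par t c))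

  -- `Gb` splits by whether `a` is the parent of `b`, `Gb′` by whether `b` and `c` are siblings. In
  -- their sum `hh` and `x₆` occur twice and each other class once, just as on the left.
  difference : total c + total a + (# (a + 1) (hCond? a) + # (a + 1) (hCond? a)) ≡ total b + total b
  difference = combine x₁ x₂ x₃ x₄ x₅ x₆ hh Ga Gb Gb′ Gc
    where
    x₁ = #₃ b (λ x y z → ¬? (y ≟ a))
    x₂ = #₃ c (λ x y z → ¬? (z ≟ b))
    x₃ = #₃ b (λ x y z → (z ≟ y) ×-dec ¬? (y ≟ a))
    x₄ = #₃ b (λ x y z → ((y ≟ a) ×-dec ¬? (z ≟ a)) ×-dec ¬? (z ≟ x))
    x₅ = #₃ b (λ x y z → ((y ≟ a) ×-dec ¬? (z ≟ a)) ×-dec (z ≟ x))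
    x₆ = # b (λ t → bc-under-a? t ×-dec ¬? (c-leaf? t))
    hh = # (a + 1) (hCond? a)
    HC : # b bc-under-a? ≡ hh + x₆
    HC = trans (#-split b bc-under-a? c-leaf?) (cong (_+ x₆) (sym h≡cherry-leaf))
    Ga : total a ≡ (x₅ + x₃) + x₁
    Ga = trans (total-split a (λ x y z → y ≟ x)) (cong₂ _+_
      (trans (#₃-split a (λ x y z → y ≟ x) (λ x y z → z ≟ b)) (cong₂ _+_ reattach sibling-pair)) swap-ab)
    Gb : total b ≡ ((hh + x₆) + (x₅ + x₄)) + x₁
    Gb = trans (total-split b (λ x y z → y ≟ a)) (cong (_+ x₁)
      (trans (#₃-split b (λ x y z → y ≟ a) (λ x y z → z ≟ a)) (cong₂ _+_ HC
        (#₃-split b (λ x y z → (y ≟ a) ×-dec ¬? (z ≟ a)) (λ x y z → z ≟ x)))))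
    Gb′ : total b ≡ ((hh + x₆) + x₃) + x₂
    Gb′ = trans (total-split b (λ x y z → z ≟ y)) (cong₂ _+_
      (trans (#₃-split b (λ x y z → z ≟ y) (λ x y z → y ≟ a)) (cong (_+ x₃) (trans (#-≡ b _ bc-under-a?
        (λ { t _ _ (e , e′) → e′ , trans e e′ }) (λ { t _ _ (e , e′) → trans e′ (sym e) , e })) HC))) swap-bc)
    Gc : total c ≡ ((x₆ + x₆) + x₄) + x₂
    Gc = trans (total-split c (λ x y z → z ≟ b)) (cong (_+ x₂)
      (trans (#₃-split c (λ x y z → z ≟ b) (λ x y z → y ≟ a)) (cong₂ _+_ nested≡2·cherry parent-child)))
    combine : ∀ x₁ x₂ x₃ x₄ x₅ x₆ hh {ga gb gc} → ga ≡ (x₅ + x₃) + x₁ → gb ≡ ((hh + x₆) + (x₅ + x₄)) + x₁ →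
      gb ≡ ((hh + x₆) + x₃) + x₂ → gc ≡ ((x₆ + x₆) + x₄) + x₂ → gc + ga + (hh + hh) ≡ gb + gb
    combine x₁ x₂ x₃ x₄ x₅ x₆ hh refl e e′ refl = trans (identity x₁ x₂ x₃ x₄ x₅ x₆ hh) (sym (cong₂ _+_ e e′))
      where
      identity : ∀ x₁ x₂ x₃ x₄ x₅ x₆ h → (((x₆ + x₆) + x₄) + x₂) + ((x₅ + x₃) + x₁) + (h + h) ≡
        (((h + x₆) + (x₅ + x₄)) + x₁) + (((h + x₆) + x₃) + x₂)
      identity = solve-∀

-- Common form of the two regions: in each, `m + 2 < N` and `k` avoids `m`, `m + 1`, `m + 2`.
second-difference : ∀ N m k → 1 ≤ m → 3 + m ≤ N → k ≢ m → k ≢ suc m → k ≢ suc (suc m) →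
  let G = λ e → length (filter (λ t → (eoc t ≟ e) ×-dec (parentOf t N ≟ k)) (trees N))
      H = length (filter (λ t → ((eoc t ≟ m + 1) ×-dec (parentOf t N ≟ k)) ×-dec hCond? m t) (trees N))
  in G (m + 2) + G m + (H + H) ≡ G (m + 1) + G (m + 1)
second-difference (suc M) m k 1≤m m<N k≢a k≢b k≢c =
  subst₂ (λ b c → total c + total m + (# (m + 1) (hCond? m) + # (m + 1) (hCond? m)) ≡ total b + total b)
    (+-comm 1 m) (+-comm 2 m) difference
  where open Main M k m 1≤m m<N k≢a k≢b k≢c

ℤ-form : ∀ x y z w → z + x + (w + w) ≡ y + y → (+ z) -ℤ (+ 2) *ℤ (+ y) +ℤ (+ x) +ℤ (+ 2) *ℤ (+ w) ≡ + 0
ℤ-form x y z w e = trans (rearrange (+ x) (+ y) (+ z) (+ w)) (ℤ.i≡j⇒i-j≡0 (cong +_ e))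
  where
  rearrange : ∀ x y z w → z -ℤ (+ 2) *ℤ y +ℤ x +ℤ (+ 2) *ℤ w ≡ (z +ℤ x +ℤ (w +ℤ w)) -ℤ (y +ℤ y)
  rearrange = ℤ-solve-∀

theorem3p1 : (n m k : ℕ) → 1 ≤ n →
    ((2 ≤ k + 1) × (k + 1 ≤ m) × (m ≤ 2 * n ∸ 2)) ⊎ ((4 ≤ m + 3) × (m + 3 ≤ k) × (k ≤ 2 * n)) →
    (+ g n (m + 2) k) -ℤ (+ 2) *ℤ (+ g n (m + 1) k) +ℤ (+ g n m k) +ℤ (+ 2) *ℤ (+ h n m k) ≡ + 0
theorem3p1 n m k 1≤n (inj₁ (_ , k<m , m≤)) = ℤ-form (g n m k) (g n (m + 1) k) (g n (m + 2) k) (h n m k)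
  (second-difference (2 * n + 1) m k (≤-trans (s≤s z≤n) k<m′) m<N
    (<⇒≢ k<m′) (<⇒≢ (m<n⇒m<1+n k<m′)) (<⇒≢ (m<n⇒m<1+n (m<n⇒m<1+n k<m′))))
  where
  k<m′ : k < m
  k<m′ = subst (_≤ m) (+-comm k 1) k<m
  m<N : 3 + m ≤ 2 * n + 1
  -- `1 ≤ n` makes the truncated `2 * n ∸ 2` a true difference.
  m<N = subst₂ _≤_ (trans (+-comm (m + 2) 1) (cong suc (+-comm m 2))) refl
    (+-monoˡ-≤ 1 (m≤o∸n⇒m+n≤o m (*-monoʳ-≤ 2 1≤n) m≤))
theorem3p1 n m k 1≤n (inj₂ (4≤m+3 , m+3≤k , k≤2n)) = ℤ-form (g n m k) (g n (m + 1) k) (g n (m + 2) k) (h n m k)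
  (second-difference (2 * n + 1) m k (+-cancelʳ-≤ 3 1 m 4≤m+3) (≤-trans c<k (≤-trans k≤2n (m≤m+n (2 * n) 1)))
    (>⇒≢ (<-trans (n<1+n m) b<k)) (>⇒≢ b<k) (>⇒≢ c<k))
  where
  c<k : suc (suc m) < k
  c<k = subst (_≤ k) (+-comm m 3) m+3≤k
  b<k : suc m < k
  b<k = <-trans (n<1+n (suc m)) c<k
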